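{- Let $n\ge1$. Then $x_{\llbracket n\rrbracket}$ is $e$-positive in $\mathrm{NCSym}$ if and only if $x_n$ is $e$-positive in $\mathrm{Sym}$.
   Context: A set partition $\pi\vdash[n]$ of $[n]=\{1,\dots,n\}$ is a collection of disjoint nonempty subsets (blocks) with union $[n]$; $\llbracket n\rrbracket$ is the set partition with the single block $[n]$. Set partitions of $[n]$ are ordered by refinement: $\sigma\le\pi$ if each block of $\sigma$ is contained in a block of $\pi$. $u$ is the Möbius function of this lattice: for $\sigma\le\pi$, $u(\sigma,\pi)=\prod_i(-1)^{k_i-1}(k_i-1)!$ where $k_i$ is the number of blocks of $\sigma$ contained in the $i$th block of $\pi$. In $\mathbb{Q}[[\mathbf{x}_1,\mathbf{x}_2,\dots]]$ (noncommuting variables), for $\pi\vdash[n]$: $p_\pi=\sum\mathbf{x}_{i_1}\cdots\mathbf{x}_{i_n}$ over all tuples of positive integers with $i_j=i_k$ whenever $j,k$ are in the same block of $\pi$; $e_\pi=\sum\mathbf{x}_{i_1}\cdots\mathbf{x}_{i_n}$ over all tuples with $i_j\ne i_k$ whenever $j\neq k$ are in the same block of $\pi$; and $x_\pi=\sum_{\sigma\le\pi}u(\sigma,\pi)\,p_\sigma$. $\mathrm{NCSym}$ is the algebra of symmetric functions in noncommuting variables; its degree-$n$ piece has each of $\{p_\pi\}_{\pi\vdash[n]}$, $\{e_\pi\}_{\pi\vdash[n]}$, $\{x_\pi\}_{\pi\vdash[n]}$ as a $\mathbb{Q}$-basis. $\mathrm{Sym}\subset\mathbb{Q}[[x_1,x_2,\dots]]$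 is the algebra of symmetric functions in commuting variables, with its usual elementary basis $e_\lambda=e_{\lambda_1}\cdots e_{\lambda_l}$ indexed by integer partitions $\lambda$, $e_i=\sum_{j_1<\cdots<j_i}x_{j_1}\cdots x_{j_i}$. Let $\rho:\mathbb{Q}[[\mathbf{x}_1,\mathbf{x}_2,\dots]]\to\mathbb{Q}[[x_1,x_2,\dots]]$ be the algebra morphism letting the variables commute ($\mathbf{x}_i\mapsto x_i$). The element $x_n\in\mathrm{Sym}$ (indexed by the integer partition of $n$ with the single part $n$, not a variable) is $x_n=\rho(x_{\llbracket n\rrbracket})$. An element of $\mathrm{NCSym}$ (respectively $\mathrm{Sym}$) is $e$-positive if all coefficients appearing (i.e. all nonzero coefficients) in its expansion in the basis $\{e_\pi\}$ (respectively $\{e_\lambda\}$) are positive. -}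

module Defs where

open import Data.Bool using (_∧_; if_then_else_)
import Data.Bool.Properties as Bool
open import Data.Fin using (Fin)
import Data.Fin.Properties as Fin
open import Data.Fin.Subset using (Subset; inside; outside; ⊤; Nonempty; Empty; _∩_)
  renaming (_∈_ to _∈ₛ_; _⊆_ to _⊆ₛ_)
open import Data.Fin.Subset.Properties using (nonempty?; ∈⊤)
  renaming (_∈?_ to _∈ₛ?_; _⊆?_ to _⊆ₛ?_)
open import Data.Integer using (ℤ; +_; -1ℤ; 1ℤ)
import Data.Integer as ℤ
open import Data.List using (List; []; _∷_; _++_; map; foldr; filter; mapMaybe; concatMap;
  cartesianProductWith; length; lookup; upTo)
open import Data.List.Properties using (map-∘; map-cong; map-++)
open import Data.List.Membership.Propositional using (_∉_)
open import Data.List.Membership.Propositional.Properties using (∈-++⁺ˡ; ∈-map⁺)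
import Data.List.Membership.Propositional as List
open import Data.List.Relation.Binary.Sublist.Propositional using (_⊆_; from∈)
import Data.List.Relation.Binary.Sublist.DecPropositional as DecSublist
open import Data.List.Relation.Unary.All using (All; []; _∷_; all?)
open import Data.List.Relation.Unary.AllPairs using (AllPairs; []; _∷_; allPairs?)
open import Data.List.Relation.Unary.Any using (Any; here; any?)
open import Data.List.Relation.Unary.Linked using (Linked)
open import Data.List.Relation.Unary.Unique.Propositional using (Unique)
open import Data.Maybe using (Maybe; just; nothing)
open import Data.Nat using (ℕ; zero; suc; _∸_; _≤_; _≥_; _<_; _!; NonZero; _≟_; _≤?_)
open import Data.Nat.ListAction using (sum)
open import Data.Nat.ListAction.Properties using (sum-++)
import Data.Nat.Properties as ℕ
open import Data.Product using (Σ; Σ-syntax; _×_; _,_)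
open import Data.Rational using (ℚ; 0ℚ; 1ℚ)
import Data.Rational as ℚ
open import Data.Vec using ([]; _∷_)
import Data.Vec.Properties as Vec
open import Function using (_∘_)
open import Relation.Binary using (Decidable)
open import Relation.Binary.PropositionalEquality
  using (_≡_; _≢_; refl; sym; trans; cong; cong₂; module ≡-Reasoning)
open import Relation.Nullary using (Dec; yes; no; does)
open import Relation.Nullary.Decidable using (_×-dec_; _→-dec_; ¬?)

private
  variable
    A B : Set
    n : ℕ

∑ : List A → (A → ℚ) → ℚ
∑ xs f = foldr ℚ._+_ 0ℚ (map f xs)

indicator : Dec A → ℚ
indicator a? = if does a? then 1ℚ else 0ℚ

sublists : List A → List (List A)
sublists []       = [] ∷ []
sublists (x ∷ xs) = map (x ∷_) (sublists xs) ++ sublists xs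

subsets : ∀ n → List (Subset n)
subsets zero    = [] ∷ []
subsets (suc n) = map (inside ∷_) (subsets n) ++ map (outside ∷_) (subsets n)

-- [n] is modelled by Fin n.
IsSetPartition : List (Subset n) → Set
IsSetPartition {n} bs =
  All Nonempty bs × AllPairs (λ B C → Empty (B ∩ C)) bs × (∀ (i : Fin n) → Any (i ∈ₛ_) bs)

-- An unordered collection of subsets of [n] is stored as a sublist of the
-- list `subsets n`, so that equal collections are propositionally equal.
record SetPartition (n : ℕ) : Set where
  constructor mkSetPartition
  field
    blocks          : List (Subset n)
    .isCollection   : blocks ⊆ subsets n
    .isSetPartition : IsSetPartition blocks

open SetPartition public

isSetPartition? : (bs : List (Subset n)) → Dec (IsSetPartition bs)
isSetPartition? bs =
  all? nonempty? bs
    ×-dec allPairs? (λ B C → ¬? (nonempty? (B ∩ C))) bs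
    ×-dec Fin.all? (λ i → any? (i ∈ₛ?_) bs)

_⊆?_ : Decidable (_⊆_ {A = Subset n})
_⊆?_ = DecSublist._⊆?_ (Vec.≡-dec Bool._≟_)

toSetPartition : List (Subset n) → Maybe (SetPartition n)
toSetPartition {n} bs with bs ⊆? subsets n | isSetPartition? bs
... | yes c | yes p = just (mkSetPartition bs c p)
... | _     | _     = nothing

-- Every set partition of [n], once.
setPartitions : ∀ n → List (SetPartition n)
setPartitions n = mapMaybe toSetPartition (sublists (subsets n))

⊤∈subsets : ∀ n → ⊤ List.∈ subsets n
⊤∈subsets zero    = here refl
⊤∈subsets (suc n) = ∈-++⁺ˡ (∈-map⁺ (inside ∷_) (⊤∈subsets n))

⟦_⟧ : ∀ n → .{{_ : NonZero n}} → SetPartition n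
⟦ suc n ⟧ = mkSetPartition (⊤ ∷ []) (from∈ (⊤∈subsets (suc n)))
  ((Fin.zero , ∈⊤) ∷ [] , [] ∷ [] , λ _ → here ∈⊤)

_≤ₚ_ : SetPartition n → SetPartition n → Set
σ ≤ₚ π = All (λ B → Any (B ⊆ₛ_) (blocks π)) (blocks σ)

_≤ₚ?_ : Decidable (_≤ₚ_ {n})
σ ≤ₚ? π = all? (λ B → any? (B ⊆ₛ?_) (blocks π)) (blocks σ)

-- μ(0̂, 1̂) in the lattice of set partitions of a k-element set, k ≥ 1.
möbius : ℕ → ℤ
möbius k = (-1ℤ ℤ.^ (k ∸ 1)) ℤ.* + ((k ∸ 1) !)

-- The Möbius function of the partition lattice; only meaningful for σ ≤ₚ π.
u : SetPartition n → SetPartition n → ℤ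
u σ π = foldr ℤ._*_ 1ℤ (map (λ C → möbius (length (filter (_⊆ₛ? C) (blocks σ)))) (blocks π))

-- The variables are indexed by ℕ = {0, 1, …} instead of {1, 2, …}; the word
-- i₁ ∷ … ∷ iₙ ∷ [] is the monomial 𝐱_{i₁} ⋯ 𝐱_{iₙ}.
Word : Set
Word = List ℕ

-- A series is given by the coefficient of each word.
NCSeries : Set
NCSeries = Word → ℚ

ConstantOn : (w : Word) → Subset (length w) → Set
ConstantOn w B = ∀ j k → j ∈ₛ B → k ∈ₛ B → lookup w j ≡ lookup w k

constantOn? : ∀ w B → Dec (ConstantOn w B)
constantOn? w B = Fin.all? λ j → Fin.all? λ k →
  (j ∈ₛ? B) →-dec ((k ∈ₛ? B) →-dec (lookup w j ≟ lookup w k))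

DistinctOn : (w : Word) → Subset (length w) → Set
DistinctOn w B = ∀ j k → j ≢ k → j ∈ₛ B → k ∈ₛ B → lookup w j ≢ lookup w k

distinctOn? : ∀ w B → Dec (DistinctOn w B)
distinctOn? w B = Fin.all? λ j → Fin.all? λ k →
  ¬? (j Fin.≟ k) →-dec ((j ∈ₛ? B) →-dec ((k ∈ₛ? B) →-dec ¬? (lookup w j ≟ lookup w k)))

pNC : SetPartition n → NCSeries
pNC {n} π w with n ≟ length w
... | yes refl = indicator (all? (constantOn? w) (blocks π))
... | no _     = 0ℚ

eNC : SetPartition n → NCSeries
eNC {n} π w with n ≟ length w
... | yes refl = indicator (all? (distinctOn? w) (blocks π))
... | no _     = 0ℚ

xNC : SetPartition n → NCSeries
xNC {n} π w = ∑ (filter (_≤ₚ? π) (setPartitions n)) λ σ → (u σ π ℚ./ 1) ℚ.* pNC σ w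

-- The exponent list e₀ ∷ … ∷ eₖ ∷ [] is the monomial x₀^e₀ ⋯ xₖ^eₖ.
Monomial : Set
Monomial = List ℕ

-- Trailing zero exponents do not change a monomial, whence `stable`.
record Series : Set where
  field
    coeff  : Monomial → ℚ
    stable : ∀ m → coeff (m ++ 0 ∷ []) ≡ coeff m

open Series public

sum-++0 : ∀ m → sum (m ++ 0 ∷ []) ≡ sum m
sum-++0 m = trans (sum-++ m (0 ∷ [])) (ℕ.+-identityʳ (sum m))

one : Series
one = record
  { coeff  = λ m → indicator (sum m ≟ 0)
  ; stable = λ m → cong (λ d → indicator (d ≟ 0)) (sum-++0 m)
  }

-- All (a , b) with a · b = m.
factorisations : Monomial → List (Monomial × Monomial)
factorisations []      = ([] , []) ∷ []
factorisations (e ∷ m) =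
  cartesianProductWith (λ i (a , b) → (i ∷ a , (e ∸ i) ∷ b)) (upTo (suc e)) (factorisations m)

pad : Monomial × Monomial → Monomial × Monomial
pad (a , b) = (a ++ 0 ∷ [] , b ++ 0 ∷ [])

map-cartesianProductWith : ∀ {A B C B′ C′ : Set}
  {f : A → B → C} {f′ : A → B′ → C′} {g : B → B′} {h : C → C′} →
  (∀ x y → f′ x (g y) ≡ h (f x y)) → ∀ xs ys →
  cartesianProductWith f′ xs (map g ys) ≡ map h (cartesianProductWith f xs ys)
map-cartesianProductWith eq []       ys = refl
map-cartesianProductWith {f = f} {f′} {g} {h} eq (x ∷ xs) ys = begin
  map (f′ x) (map g ys) ++ cartesianProductWith f′ xs (map g ys)
    ≡⟨ cong₂ _++_ (trans (sym (map-∘ ys)) (trans (map-cong (eq x) ys) (map-∘ ys)))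
                  (map-cartesianProductWith eq xs ys) ⟩
  map h (map (f x) ys) ++ map h (cartesianProductWith f xs ys)
    ≡⟨ map-++ h (map (f x) ys) _ ⟨
  map h (cartesianProductWith f (x ∷ xs) ys) ∎
  where open ≡-Reasoning

factorisations-++0 : ∀ m → factorisations (m ++ 0 ∷ []) ≡ map pad (factorisations m)
factorisations-++0 []      = refl
factorisations-++0 (e ∷ m) rewrite factorisations-++0 m =
  map-cartesianProductWith (λ _ _ → refl) (upTo (suc e)) (factorisations m)

infixl 7 _·_

_·_ : Series → Series → Series
f · g = record
  { coeff  = λ m → ∑ (factorisations m) term
  ; stable = λ m → cong (foldr ℚ._+_ 0ℚ) (begin
      map term (factorisations (m ++ 0 ∷ []))   ≡⟨ cong (map term) (factorisations-++0 m) ⟩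
      map term (map pad (factorisations m))     ≡⟨ map-∘ (factorisations m) ⟨
      map (term ∘ pad) (factorisations m)       ≡⟨ map-cong (λ (a , b) →
                                                     cong₂ ℚ._*_ (stable f a) (stable g b)) _ ⟩
      map term (factorisations m)               ∎)
  }
  where
  open ≡-Reasoning
  term : Monomial × Monomial → ℚ
  term (a , b) = coeff f a ℚ.* coeff g b

squarefree? : (m : Monomial) → Dec (All (_≤ 1) m)
squarefree? = all? (_≤? 1)

squarefree-++0 : ∀ m → does (squarefree? (m ++ 0 ∷ [])) ≡ does (squarefree? m)
squarefree-++0 []      = refl
squarefree-++0 (e ∷ m) rewrite squarefree-++0 m = refl

-- e_i: the sum of all squarefree monomials of degree i.
elementary : ℕ → Series
elementary i = record
  { coeff  = λ m → indicator (squarefree? m ×-dec (sum m ≟ i))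
  ; stable = λ m → cong₂ (λ b d → if b ∧ does (d ≟ i) then 1ℚ else 0ℚ)
                         (squarefree-++0 m) (sum-++0 m)
  }

record IntegerPartition : Set where
  constructor mkIntegerPartition
  field
    parts       : List ℕ
    .decreasing : Linked _≥_ parts
    .positive   : All (0 <_) parts

open IntegerPartition public

eSym : IntegerPartition → Series
eSym μ = foldr (λ i f → elementary i · f) one (parts μ)

-- All (i , m′) with x_i · m′ = m.
firstLetters : Monomial → List (ℕ × Monomial)
firstLetters []          = []
firstLetters (zero ∷ m)  = map (λ (i , m′) → (suc i , zero ∷ m′)) (firstLetters m)
firstLetters (suc e ∷ m) =
  (0 , e ∷ m) ∷ map (λ (i , m′) → (suc i , suc e ∷ m′)) (firstLetters m)

-- For m of degree d, all words of length d in which each letter i occurs as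
-- often as the exponent of x_i in m.
arrangements : ℕ → Monomial → List Word
arrangements zero    m = [] ∷ []
arrangements (suc d) m =
  concatMap (λ (i , m′) → map (i ∷_) (arrangements d m′)) (firstLetters m)

pad₂ : ℕ × Monomial → ℕ × Monomial
pad₂ (i , m) = (i , m ++ 0 ∷ [])

firstLetters-++0 : ∀ m → firstLetters (m ++ 0 ∷ []) ≡ map pad₂ (firstLetters m)
firstLetters-++0 []          = refl
firstLetters-++0 (zero ∷ m)  rewrite firstLetters-++0 m =
  trans (sym (map-∘ (firstLetters m))) (map-∘ (firstLetters m))
firstLetters-++0 (suc e ∷ m) rewrite firstLetters-++0 m =
  cong ((0 , e ∷ m ++ 0 ∷ []) ∷_) (trans (sym (map-∘ (firstLetters m))) (map-∘ (firstLetters m)))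

arrangements-++0 : ∀ d m → arrangements d (m ++ 0 ∷ []) ≡ arrangements d m
arrangements-++0 zero    m = refl
arrangements-++0 (suc d) m rewrite firstLetters-++0 m =
  cong (foldr _++_ []) (trans (sym (map-∘ (firstLetters m)))
    (map-cong (λ (i , m′) → cong (map (i ∷_)) (arrangements-++0 d m′)) (firstLetters m)))

-- The algebra morphism 𝐱_i ↦ x_i: the coefficient of a monomial m in ρ f is
-- the sum of the coefficients in f of the finitely many words mapped to m.
ρ : NCSeries → Series
ρ f = record
  { coeff  = λ m → ∑ (arrangements (sum m) m) f
  ; stable = λ m → cong (λ ws → ∑ ws f)
      (trans (arrangements-++0 (sum (m ++ 0 ∷ [])) m)
             (cong (λ d → arrangements d m) (sum-++0 m)))
  }

xSym : ∀ n → .{{_ : NonZero n}} → Series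
xSym n = ρ (xNC ⟦ n ⟧)

-- An expansion of f as a finite linear combination of the family b, where a
-- series is identified with its coefficient function on the monomials M.
record Expansion {I M : Set} (b : I → M → ℚ) (f : M → ℚ) : Set where
  field
    coefficient : I → ℚ
    support     : List I
    distinct    : Unique support
    finite      : ∀ i → i ∉ support → coefficient i ≡ 0ℚ
    expands     : ∀ m → f m ≡ ∑ support (λ i → coefficient i ℚ.* b i m)

open Expansion public

-- Since the families used below are linearly independent, "some expansion"
-- is the same as "the expansion".
PositiveIn : {I M : Set} → (I → M → ℚ) → (M → ℚ) → Set
PositiveIn b f = Σ[ x ∈ Expansion b f ] (∀ i → coefficient x i ≢ 0ℚ → 0ℚ ℚ.< coefficient x i)

EPositiveNC : NCSeries → Set
EPositiveNC = PositiveIn {I = Σ ℕ SetPartition} (λ (_ , π) → eNC π)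

EPositiveSym : Series → Set
EPositiveSym f = PositiveIn (λ μ → coeff (eSym μ)) (coeff f)

{-# OPTIONS --safe #-}

-- A symmetric series f in noncommuting variables is recovered from ρ f: the
-- coefficient of a word w in f is that of the monomial of w in ρ f, divided by
-- the number of arrangements of w.  Both ρ and this lifting preserve
-- e-positivity.  Indeed, label the blocks of π by a word b; then e_π is the sum
-- of the words w for which the pairs (b_i , w_i) are distinct.  Permuting the
-- positions shows that ρ e_π = λ! e_λ, λ the shape of π, and since the
-- condition is symmetric in b and w, double counting shows that the lifting of
-- e_λ is a positive multiple of the sum of the e_π over all labellings b by
-- the arrangements of 1^λ₁ 2^λ₂ ⋯.  So the equivalence holds for every symmetric
-- series, and x_⟦n⟧ is symmetric because u(σ, ⟦n⟧) depends only on the number of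
-- blocks of σ.
module Submission where

open import Defs
open import Algebra.Bundles using (CommutativeMonoid)
import Algebra.Properties.CommutativeSemigroup as CommutativeSemigroup
open import Data.Bool using (true; false)
import Data.Bool.Properties as Bool
open import Data.Empty using (⊥-elim)
open import Data.Fin using (Fin)
import Data.Fin as Fin
import Data.Fin.Properties as Fin
open import Data.Fin.Subset using (Subset; inside; outside; ⊤; Nonempty; Empty; _∩_)
  renaming (_∈_ to _∈ₛ_; _∉_ to _∉ₛ_)
open import Data.Fin.Subset.Properties using (⊆-antisym; ⊆-max; x∈p∩q⁺; x∈p∩q⁻)
  renaming (_∈?_ to _∈ₛ?_; _⊆?_ to _⊆ₛ?_)
open import Data.Integer using (1ℤ)
import Data.Integer as ℤ
open import Data.List using (List; []; _∷_; _++_; map; concatMap; foldr; filter; mapMaybe;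
  length; lookup; replicate; zip; take; drop; upTo; tabulate; allFin; deduplicate; cartesianProduct)
open import Data.List.Properties using (map-++; map-∘; map-id; map-cong-local; map-tabulate;
  length-map; length-++; length-replicate; length-take; length-tabulate; mapMaybe-++;
  mapMaybe-map-retract; filter-++; filter-all; filter-accept; filter-reject; take++drop≡id;
  zip-map; zip-flip; tabulate-lookup; ∷-injective; ≡-dec)
open import Data.List.Membership.Propositional using (_∈_; _∉_; find; lose)
open import Data.List.Membership.Propositional.Properties
  using (∈-map⁺; ∈-map⁻; ∈-++⁺ˡ; ∈-++⁺ʳ; ∈-++⁻; ∈-concat⁺′; ∈-concat⁻′; ∈-filter⁺; ∈-filter⁻;
   ∈-upTo⁺; ∈-upTo⁻; ∈-cartesianProductWith⁺; ∈-cartesianProductWith⁻; ∈-cartesianProduct⁺;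
   ∈-cartesianProduct⁻; ∈-tabulate⁺; ∈-tabulate⁻; ∈-allFin; ∈-length; ∈-deduplicate⁺;
   ∈-deduplicate⁻)
open import Data.List.Membership.Propositional.Properties.WithK using (unique∧set⇒bag)
open import Data.List.Relation.Binary.BagAndSetEquality using (∼bag⇒↭)
open import Data.List.Relation.Binary.Permutation.Propositional
  using (_↭_; refl; prep; swap; trans; ↭-sym; ↭-reflexive; ↭⇒↭ₛ)
open import Data.List.Relation.Binary.Permutation.Propositional.Properties
  using (∈-resp-↭; All-resp-↭; Any-resp-↭; ↭-length; ↭-map-inv; ++⁺; ++⁺ˡ; shift; drop-∷;
   mapMaybe-↭; filter-↭; ↭-sym-involutive; ++-commutativeMonoid; ¬x∷xs↭[])
  renaming (map⁺ to map⁺-↭)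
import Data.List.Relation.Binary.Permutation.Setoid.Properties as SetoidPermutation
open import Data.List.Relation.Binary.Sublist.Propositional using (_⊆_; []; _∷_; _∷ʳ_)
  renaming (lookup to ⊆-lookup)
open import Data.List.Relation.Binary.Sublist.Propositional.Properties using (filter-⊆)
open import Data.List.Relation.Unary.All as All using (All; []; _∷_; all?)
import Data.List.Relation.Unary.All.Properties as All
open import Data.List.Relation.Unary.AllPairs as AllPairs using (AllPairs; []; _∷_)
import Data.List.Relation.Unary.AllPairs.Properties as AllPairs
open import Data.List.Relation.Unary.Any as Any using (Any; here; there)
import Data.List.Relation.Unary.Linked.Properties as Linked
open import Data.List.Relation.Unary.Unique.Propositional using (Unique)
import Data.List.Relation.Unary.Unique.Propositional.Properties as Unique
import Data.List.Relation.Unary.Unique.DecPropositional as DecUnique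
import Data.List.Relation.Unary.Unique.DecPropositional.Properties as DecUnique
import Data.List.Sort as Sort
open import Data.Maybe using (Maybe; just; nothing)
open import Data.Nat as ℕ using (ℕ; zero; suc; _∸_; z≤n; s≤s; _≟_; NonZero)
open import Data.Nat.ListAction using (sum)
import Data.Nat.Properties as ℕ
open import Data.Product using (Σ-syntax; ∃-syntax; _×_; _,_; proj₁; proj₂; uncurry; map₁)
open import Data.Product.Properties using (,-injective; ,-injectiveˡ; ,-injectiveʳ)
  renaming (≡-dec to ×-≡-dec)
open import Data.Rational as ℚ using (ℚ; 0ℚ; 1ℚ; _+_; _*_; _≤_; _<_; nonNegative; 1/_)
  renaming (positive to 0<⇒Positive)
open import Data.Rational.Properties as ℚ using (+-assoc; +-identityˡ; +-identityʳ; *-comm; *-assoc;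
  *-identityˡ; *-zeroˡ; *-zeroʳ; *-distribˡ-+)
open import Data.Sum using (inj₁; inj₂)
import Data.Vec as Vec
import Data.Vec.Properties as Vec
open import Function using (_∘_; id)
open import Function.Bundles using (_⇔_; mk⇔; Equivalence)
open import Relation.Binary using (DecidableEquality; DecTotalOrder)
import Relation.Binary.Construct.Flip.EqAndOrd as Flip
import Relation.Binary.Construct.On as On
open import Relation.Binary.PropositionalEquality
  using (_≡_; _≢_; refl; sym; cong; cong₂; subst; subst₂; setoid; resp₂; module ≡-Reasoning)
  renaming (trans to ≡-trans)
open import Relation.Nullary using (¬_; Dec; yes; no; does; recompute)
open import Relation.Nullary.Decidable using (_×-dec_; _→-dec_; dec-true; dec-false; map′)
open import Relation.Unary using (Decidable)

open Equivalence using (to; from)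
open ≡-Reasoning

-- A single e_π is in general not invariant under permutations of the positions, so the lift of e_λ
-- has to average over all labellings. Different labellings may give the same π, and different π may
-- have the same shape; both directions therefore first produce a combination with repeated members.
-- Every weight is nonnegative, so collecting equal members cannot cancel anything. Permutations
-- occur in two forms: as an action on lists of letters where words are counted, and as a bijection
-- of positions where set partitions are moved.

module + = CommutativeSemigroup (CommutativeMonoid.commutativeSemigroup ℚ.+-0-commutativeMonoid)
module * = CommutativeSemigroup (CommutativeMonoid.commutativeSemigroup ℚ.*-1-commutativeMonoid)

private
  variable
    A B I M : Set
    x : A
    xs ys : List A
    m : Monomial
    n : ℕ

-- Rational numbers

pos*pos : ∀ {p q} → 0ℚ < p → 0ℚ < q → 0ℚ < p * q
pos*pos {p} {q} 0<p 0<q =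
  ℚ.positive⁻¹ (p * q) {{ℚ.pos*pos⇒pos p {{0<⇒Positive 0<p}} q {{0<⇒Positive 0<q}}}}

nonNeg*nonNeg : ∀ {p q} → 0ℚ ≤ p → 0ℚ ≤ q → 0ℚ ≤ p * q
nonNeg*nonNeg {p} {q} 0≤p 0≤q = ℚ.nonNegative⁻¹ (p * q)
  {{ℚ.nonNeg*nonNeg⇒nonNeg p {{nonNegative 0≤p}} q {{nonNegative 0≤q}}}}

≢0⇒pos⇒nonNeg : ∀ {p} → (p ≢ 0ℚ → 0ℚ < p) → 0ℚ ≤ p
≢0⇒pos⇒nonNeg {p} h with p ℚ.≟ 0ℚ
... | yes refl = ℚ.≤-refl
... | no p≢0   = ℚ.<⇒≤ (h p≢0)

nonNeg⇒≢0⇒pos : ∀ {p} → 0ℚ ≤ p → p ≢ 0ℚ → 0ℚ < p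
nonNeg⇒≢0⇒pos {p} 0≤p p≢0 with 0ℚ ℚ.<? p
... | yes 0<p = 0<p
... | no 0≮p  = ⊥-elim (p≢0 (ℚ.≤-antisym (ℚ.≮⇒≥ 0≮p) 0≤p))

reciprocal : ∀ {p} → 0ℚ < p → ∃[ r ] 0ℚ < r × r * p ≡ 1ℚ
reciprocal {p} 0<p = r , ℚ.positive⁻¹ r {{ℚ.1/pos⇒pos p {{0<⇒Positive 0<p}}}} ,
  ℚ.*-inverseˡ p {{ℚ.pos⇒nonZero p {{0<⇒Positive 0<p}}}}
  where r = (1/ p) {{ℚ.pos⇒nonZero p {{0<⇒Positive 0<p}}}}

indicator-yes : (a? : Dec A) → A → indicator a? ≡ 1ℚ
indicator-yes (yes _) a = refl
indicator-yes (no ¬a) a = ⊥-elim (¬a a)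

indicator-no : (a? : Dec A) → ¬ A → indicator a? ≡ 0ℚ
indicator-no (yes a) ¬a = ⊥-elim (¬a a)
indicator-no (no _)  ¬a = refl

indicator-cong : (a? : Dec A) (b? : Dec B) → (A → B) → (B → A) → indicator a? ≡ indicator b?
indicator-cong (yes a) b? to from = sym (indicator-yes b? (to a))
indicator-cong (no ¬a) b? to from = sym (indicator-no b? (¬a ∘ from))

indicator-× : (a? : Dec A) (b? : Dec B) → indicator (a? ×-dec b?) ≡ indicator a? * indicator b?
indicator-× (yes _) b? = sym (*-identityˡ (indicator b?))
indicator-× (no _)  b? = sym (*-zeroˡ (indicator b?))

-- Finite sums

∑-cong : (xs : List A) {f g : A → ℚ} → (∀ {x} → x ∈ xs → f x ≡ g x) → ∑ xs f ≡ ∑ xs g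
∑-cong xs eq = cong (foldr _+_ 0ℚ) (map-cong-local (All.tabulate eq))

∑-map : (g : A → B) (xs : List A) (f : B → ℚ) → ∑ (map g xs) f ≡ ∑ xs (f ∘ g)
∑-map g xs f = cong (foldr _+_ 0ℚ) (sym (map-∘ xs))

∑-++ : (xs ys : List A) (f : A → ℚ) → ∑ (xs ++ ys) f ≡ ∑ xs f + ∑ ys f
∑-++ []       ys f = sym (+-identityˡ (∑ ys f))
∑-++ (x ∷ xs) ys f =
  ≡-trans (cong (f x +_) (∑-++ xs ys f)) (sym (+-assoc (f x) (∑ xs f) (∑ ys f)))

∑-concatMap : (g : A → List B) (xs : List A) (f : B → ℚ) →
  ∑ (concatMap g xs) f ≡ ∑ xs (λ x → ∑ (g x) f)
∑-concatMap g []       f = refl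
∑-concatMap g (x ∷ xs) f =
  ≡-trans (∑-++ (g x) (concatMap g xs) f) (cong (∑ (g x) f +_) (∑-concatMap g xs f))

∑-zero : (xs : List A) → ∑ xs (λ _ → 0ℚ) ≡ 0ℚ
∑-zero []       = refl
∑-zero (x ∷ xs) = ≡-trans (+-identityˡ _) (∑-zero xs)

∑-+ : (xs : List A) (f g : A → ℚ) → ∑ xs (λ x → f x + g x) ≡ ∑ xs f + ∑ xs g
∑-+ []       f g = refl
∑-+ (x ∷ xs) f g =
  ≡-trans (cong (f x + g x +_) (∑-+ xs f g)) (+.interchange (f x) (g x) (∑ xs f) (∑ xs g))

∑-*ˡ : (c : ℚ) (xs : List A) (f : A → ℚ) → ∑ xs (λ x → c * f x) ≡ c * ∑ xs f
∑-*ˡ c []       f = sym (*-zeroʳ c)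
∑-*ˡ c (x ∷ xs) f =
  ≡-trans (cong (c * f x +_) (∑-*ˡ c xs f)) (sym (*-distribˡ-+ c (f x) (∑ xs f)))

∑-*ʳ : (c : ℚ) (xs : List A) (f : A → ℚ) → ∑ xs (λ x → f x * c) ≡ ∑ xs f * c
∑-*ʳ c xs f = ≡-trans (∑-cong xs (λ {x} _ → *-comm (f x) c))
  (≡-trans (∑-*ˡ c xs f) (*-comm c (∑ xs f)))

∑-swap : (xs : List A) (ys : List B) (f : A → B → ℚ) →
  ∑ xs (λ x → ∑ ys (f x)) ≡ ∑ ys (λ y → ∑ xs (λ x → f x y))
∑-swap []       ys f = sym (∑-zero ys)
∑-swap (x ∷ xs) ys f =
  ≡-trans (cong (∑ ys (f x) +_) (∑-swap xs ys f)) (sym (∑-+ ys (f x) _))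

∑-↭ : (f : A → ℚ) → xs ↭ ys → ∑ xs f ≡ ∑ ys f
∑-↭ f refl          = refl
∑-↭ f (prep x p)    = cong (f x +_) (∑-↭ f p)
∑-↭ f (trans p q)   = ≡-trans (∑-↭ f p) (∑-↭ f q)
∑-↭ {xs = _ ∷ _ ∷ xs} {ys = _ ∷ _ ∷ ys} f (swap x y p) = begin
  f x + (f y + ∑ xs f) ≡⟨ cong (λ s → f x + (f y + s)) (∑-↭ f p) ⟩
  f x + (f y + ∑ ys f) ≡⟨ +.x∙yz≈y∙xz (f x) (f y) (∑ ys f) ⟩
  f y + (f x + ∑ ys f) ∎

∑-nonNeg : (xs : List A) {f : A → ℚ} → (∀ {x} → x ∈ xs → 0ℚ ≤ f x) → 0ℚ ≤ ∑ xs f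
∑-nonNeg []       0≤f = ℚ.≤-refl
∑-nonNeg (x ∷ xs) 0≤f = ℚ.+-mono-≤ (0≤f (here refl)) (∑-nonNeg xs (0≤f ∘ there))

card : List A → ℚ
card xs = ∑ xs (λ _ → 1ℚ)

∑-const : (xs : List A) {f : A → ℚ} {c : ℚ} → (∀ {x} → x ∈ xs → f x ≡ c) → ∑ xs f ≡ card xs * c
∑-const xs {c = c} f≡c = ≡-trans
  (∑-cong xs (λ x∈xs → ≡-trans (f≡c x∈xs) (sym (*-identityˡ c)))) (∑-*ʳ c xs (λ _ → 1ℚ))

card>0 : x ∈ xs → 0ℚ < card xs
card>0 {xs = _ ∷ xs} _ = ℚ.+-mono-<-≤ (ℚ.positive⁻¹ 1ℚ)
  (∑-nonNeg xs (λ _ → ℚ.nonNegative⁻¹ 1ℚ))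

unique-↭ : Unique xs → Unique ys →
  (∀ {z} → z ∈ xs → z ∈ ys) → (∀ {z} → z ∈ ys → z ∈ xs) → xs ↭ ys
unique-↭ xs! ys! to from = ∼bag⇒↭ (unique∧set⇒bag xs! ys! (mk⇔ to from))

unique-map : {f : A → B} → (∀ {x y} → x ∈ xs → y ∈ xs → f x ≡ f y → x ≡ y) →
  Unique xs → Unique (map f xs)
unique-map inj []           = []
unique-map inj (x∉xs ∷ xs!) =
  All.map⁺ (All.tabulate λ y∈xs eq → All.lookup x∉xs y∈xs (inj (here refl) (there y∈xs) eq))
  ∷ unique-map (λ p q → inj (there p) (there q)) xs!

map-↭ : Unique xs → Unique ys → (φ : A → B) (ψ : B → A) →
  (∀ {x} → x ∈ xs → φ x ∈ ys) → (∀ {y} → y ∈ ys → ψ y ∈ xs) →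
  (∀ {x} → x ∈ xs → ψ (φ x) ≡ x) → (∀ {y} → y ∈ ys → φ (ψ y) ≡ y) →
  map φ xs ↭ ys
map-↭ {xs = xs} {ys = ys} xs! ys! φ ψ φ∈ ψ∈ ψφ φψ = unique-↭
  (unique-map (λ p q eq → ≡-trans (sym (ψφ p)) (≡-trans (cong ψ eq) (ψφ q))) xs!) ys! include
  (λ y∈ys → subst (_∈ map φ xs) (φψ y∈ys) (∈-map⁺ φ (ψ∈ y∈ys)))
  where
  include : ∀ {z} → z ∈ map φ xs → z ∈ ys
  include z∈ with _ , x∈xs , refl ← ∈-map⁻ φ z∈ = φ∈ x∈xs

-- The maps have to be inverse only on the lists themselves. Thus cutting a word, which undoes
-- concatenation only at the right length, can serve as one of them.
∑-bijection : {xs : List A} {ys : List B} {f : A → ℚ} {g : B → ℚ} →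
  Unique xs → Unique ys → (φ : A → B) (ψ : B → A) →
  (∀ {x} → x ∈ xs → φ x ∈ ys) → (∀ {y} → y ∈ ys → ψ y ∈ xs) →
  (∀ {x} → x ∈ xs → ψ (φ x) ≡ x) → (∀ {y} → y ∈ ys → φ (ψ y) ≡ y) →
  (∀ {x} → x ∈ xs → f x ≡ g (φ x)) → ∑ xs f ≡ ∑ ys g
∑-bijection {xs = xs} {ys} {f} {g} xs! ys! φ ψ φ∈ ψ∈ ψφ φψ f≡gφ = begin
  ∑ xs f           ≡⟨ ∑-cong xs f≡gφ ⟩
  ∑ xs (g ∘ φ)     ≡⟨ ∑-map φ xs g ⟨
  ∑ (map φ xs) g   ≡⟨ ∑-↭ g (map-↭ xs! ys! φ ψ φ∈ ψ∈ ψφ φψ) ⟩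
  ∑ ys g           ∎

module _ (_≟_ : DecidableEquality I) where

  ∑-indicator-∉ : ∀ {j} (is : List I) (f : I → ℚ) → j ∉ is →
    ∑ is (λ i → indicator (j ≟ i) * f i) ≡ 0ℚ
  ∑-indicator-∉ {j} is f j∉is = ≡-trans
    (∑-cong is (λ {i} i∈is → ≡-trans
      (cong (_* f i) (indicator-no (j ≟ i) (λ { refl → j∉is i∈is }))) (*-zeroˡ (f i))))
    (∑-zero is)

  ∑-indicator-∈ : ∀ {j is} (f : I → ℚ) → Unique is → j ∈ is →
    ∑ is (λ i → indicator (j ≟ i) * f i) ≡ f j
  ∑-indicator-∈ {j} {_ ∷ is} f (j∉is ∷ is!) (here refl) = begin
    indicator (j ≟ j) * f j + ∑ is (λ i → indicator (j ≟ i) * f i)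
      ≡⟨ cong₂ _+_ (cong (_* f j) (indicator-yes (j ≟ j) refl))
                   (∑-indicator-∉ is f (λ j∈is → All.lookup j∉is j∈is refl)) ⟩
    1ℚ * f j + 0ℚ ≡⟨ +-identityʳ _ ⟩
    1ℚ * f j      ≡⟨ *-identityˡ (f j) ⟩
    f j           ∎
  ∑-indicator-∈ {j} {i ∷ is} f (i∉is ∷ is!) (there j∈is) = begin
    indicator (j ≟ i) * f i + ∑ is (λ i → indicator (j ≟ i) * f i)
      ≡⟨ cong₂ _+_ (cong (_* f i) (indicator-no (j ≟ i) (λ { refl → All.lookup i∉is j∈is refl })))
                   (∑-indicator-∈ f is! j∈is) ⟩
    0ℚ * f i + f j ≡⟨ cong (_+ f j) (*-zeroˡ (f i)) ⟩
    0ℚ + f j       ≡⟨ +-identityˡ (f j) ⟩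
    f j            ∎

  -- A combination in which members of the family may be repeated.
  nonNegative-combination : {b : I → M → ℚ} {f : M → ℚ} (terms : List (I × ℚ)) →
    (∀ {i q} → (i , q) ∈ terms → 0ℚ ≤ q) →
    (∀ m → f m ≡ ∑ terms (λ (i , q) → q * b i m)) → PositiveIn b f
  nonNegative-combination {b = b} {f} terms 0≤q f≡ = expansion , λ i → nonNeg⇒≢0⇒pos
    (∑-nonNeg terms (λ {(j , q)} t∈ → nonNeg*nonNeg (0≤indicator (j ≟ i)) (0≤q t∈)))
    where
    0≤indicator : ∀ {A} (a? : Dec A) → 0ℚ ≤ indicator a?
    0≤indicator (yes _) = ℚ.nonNegative⁻¹ 1ℚ
    0≤indicator (no _)  = ℚ.≤-refl

    collected : I → ℚ
    collected i = ∑ terms (λ (j , q) → indicator (j ≟ i) * q)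

    indices : List I
    indices = deduplicate _≟_ (map proj₁ terms)

    indices! : Unique indices
    indices! = DecUnique.deduplicate-! _≟_ (map proj₁ terms)

    index∈ : ∀ {i q} → (i , q) ∈ terms → i ∈ indices
    index∈ t∈ = ∈-deduplicate⁺ _≟_ (∈-map⁺ proj₁ t∈)

    expansion : Expansion b f
    expansion = record
      { coefficient = collected
      ; support     = indices
      ; distinct    = indices!
      ; finite      = λ i i∉ → ≡-trans
          (∑-cong terms (λ {(j , q)} t∈ → ≡-trans
            (cong (_* q) (indicator-no (j ≟ i) (λ { refl → i∉ (index∈ t∈) }))) (*-zeroˡ q)))
          (∑-zero terms)
      ; expands     = λ m → begin
          f m                                  ≡⟨ f≡ m ⟩
          ∑ terms (λ (j , q) → q * b j m)
            -- Each term is spread over all of `indices`, where only the place i = j contributes;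
            -- then the two sums can be exchanged.
            ≡⟨ ∑-cong terms (λ {(j , q)} t∈ →
                 ∑-indicator-∈ (λ i → q * b i m) indices! (index∈ t∈)) ⟨
          ∑ terms (λ (j , q) → ∑ indices (λ i → indicator (j ≟ i) * (q * b i m)))
            ≡⟨ ∑-swap terms indices _ ⟩
          ∑ indices (λ i → ∑ terms (λ (j , q) → indicator (j ≟ i) * (q * b i m)))
            ≡⟨ ∑-cong indices (λ {i} _ → ≡-trans
                 (∑-cong terms (λ {(j , q)} _ → sym (*-assoc (indicator (j ≟ i)) q (b i m))))
                 (∑-*ʳ (b i m) terms (λ (j , q) → indicator (j ≟ i) * q))) ⟩
          ∑ indices (λ i → collected i * b i m) ∎
      }

-- Duplicate-free lists, concatenations and filtered sums

unique-resp-↭ : xs ↭ ys → Unique xs → Unique ys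
unique-resp-↭ p = SetoidPermutation.Unique-resp-↭ (setoid _) (↭⇒↭ₛ p)

unique-++⁻ : ∀ (xs : List A) {ys} → Unique (xs ++ ys) → Unique xs × Unique ys
unique-++⁻ []       ys!         = [] , ys!
unique-++⁻ (x ∷ xs) (x∉ ∷ xsys!) with xs! , ys! ← unique-++⁻ xs xsys! = All.++⁻ˡ xs x∉ ∷ xs! , ys!

∈-concatMap⁺′ : ∀ {f : A → List B} {x y} → x ∈ xs → y ∈ f x → y ∈ concatMap f xs
∈-concatMap⁺′ {f = f} x∈xs y∈fx = ∈-concat⁺′ y∈fx (∈-map⁺ f x∈xs)

∈-concatMap⁻′ : ∀ (f : A → List B) (xs : List A) {y} → y ∈ concatMap f xs →
  ∃[ x ] x ∈ xs × y ∈ f x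
∈-concatMap⁻′ f xs y∈ with _ , y∈ys , ys∈ ← ∈-concat⁻′ (map f xs) y∈
  with x , x∈xs , refl ← ∈-map⁻ f ys∈ = x , x∈xs , y∈ys

unique-concatMap : {f : A → List B} → Unique xs → (∀ {x} → x ∈ xs → Unique (f x)) →
  (∀ {x x′ y} → x ∈ xs → x′ ∈ xs → y ∈ f x → y ∈ f x′ → x ≡ x′) → Unique (concatMap f xs)
unique-concatMap []           f! disjoint = []
unique-concatMap {xs = x ∷ xs} {f = f} (x∉xs ∷ xs!) f! disjoint =
  Unique.++⁺ (f! (here refl))
    (unique-concatMap xs! (f! ∘ there) (λ p q → disjoint (there p) (there q)))
    λ (y∈fx , y∈) → let x′ , x′∈xs , y∈fx′ = ∈-concatMap⁻′ f xs y∈ in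
      All.lookup x∉xs x′∈xs (disjoint (here refl) (there x′∈xs) y∈fx y∈fx′)

∑-cartesianProduct : (xs : List A) (ys : List B) (f : A × B → ℚ) →
  ∑ (cartesianProduct xs ys) f ≡ ∑ xs (λ x → ∑ ys (λ y → f (x , y)))
∑-cartesianProduct []       ys f = refl
∑-cartesianProduct (x ∷ xs) ys f = ≡-trans (∑-++ (map (x ,_) ys) _ f)
  (cong₂ _+_ (∑-map (x ,_) ys f) (∑-cartesianProduct xs ys f))

∑-filter : ∀ {P : A → Set} (P? : Decidable P) (xs : List A) {f : A → ℚ} →
  (∀ {x} → x ∈ xs → ¬ P x → f x ≡ 0ℚ) → ∑ (filter P? xs) f ≡ ∑ xs f
∑-filter P? []       f≡0 = refl
∑-filter P? (x ∷ xs) {f} f≡0 with P? x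
... | yes _  = cong (f x +_) (∑-filter P? xs (f≡0 ∘ there))
... | no ¬Px = ≡-trans (∑-filter P? xs (f≡0 ∘ there))
  (≡-trans (sym (+-identityˡ _)) (cong (_+ ∑ xs f) (sym (f≡0 (here refl) ¬Px))))

-- The weakly increasing words

-- A word has the monomial `m` exactly when it is a permutation of `runs m`. Applied to the parts of
-- an integer partition, the same word serves as a labelling of blocks, with labels starting at 0.
runs : Monomial → Word
runs []      = []
runs (e ∷ m) = replicate e 0 ++ map suc (runs m)

length-runs : ∀ m → length (runs m) ≡ sum m
length-runs []      = refl
length-runs (e ∷ m) = begin
  length (replicate e 0 ++ map suc (runs m))         ≡⟨ length-++ (replicate e 0) ⟩
  length (replicate e 0) ℕ.+ length (map suc (runs m))
    ≡⟨ cong₂ ℕ._+_ (length-replicate e) (≡-trans (length-map suc (runs m)) (length-runs m)) ⟩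
  e ℕ.+ sum m                                        ∎

lower : ℕ → Maybe ℕ
lower zero    = nothing
lower (suc i) = just i

-- Together with `zeros` this inverts one step of the recursion of `runs`. Both respect
-- permutations, so exponents can be read off a word in any order.
lowered : Word → Word
lowered = mapMaybe lower

zeros : Word → ℕ
zeros w = length (filter (_≟ 0) w)

lowered-runs : ∀ e m → lowered (runs (e ∷ m)) ≡ runs m
lowered-runs zero    m = mapMaybe-map-retract (λ _ → refl) (runs m)
lowered-runs (suc e) m = lowered-runs e m

zeros-runs : ∀ e m → zeros (runs (e ∷ m)) ≡ e
zeros-runs (suc e) m = cong suc (zeros-runs e m)
zeros-runs zero    m = none (runs m)
  where
  none : ∀ w → zeros (map suc w) ≡ 0
  none []      = refl
  none (_ ∷ w) = none w

zeros-↭ : ∀ {v w} → v ↭ w → zeros v ≡ zeros w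
zeros-↭ p = ↭-length (filter-↭ (_≟ 0) p)

zeros-++ : ∀ v w → zeros (v ++ w) ≡ zeros v ℕ.+ zeros w
zeros-++ v w = ≡-trans (cong length (filter-++ (_≟ 0) v w)) (length-++ (filter (_≟ 0) v))

decomposition : ∀ w → w ↭ replicate (zeros w) 0 ++ map suc (lowered w)
decomposition []          = refl
decomposition (zero ∷ w)  = prep 0 (decomposition w)
decomposition (suc i ∷ w) = trans (prep (suc i) (decomposition w))
  (↭-sym (shift (suc i) (replicate (zeros w) 0) (map suc (lowered w))))

-- `zeros` recovers the first exponent and `lowered` the rest. Trailing zero exponents are invisible
-- in `runs`, whence the condition on the lengths.
runs-injective : ∀ m m′ → length m ≡ length m′ → runs m ↭ runs m′ → m ≡ m′
runs-injective []      []        _  _ = refl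
runs-injective (e ∷ m) (e′ ∷ m′) eq p = cong₂ _∷_
  (≡-trans (sym (zeros-runs e m)) (≡-trans (zeros-↭ p) (zeros-runs e′ m′)))
  (runs-injective m m′ (ℕ.suc-injective eq) (trans (↭-reflexive (sym (lowered-runs e m)))
    (trans (mapMaybe-↭ lower p) (↭-reflexive (lowered-runs e′ m′)))))

runs-insert : ∀ i m → ∃[ m′ ] i ∷ runs m ↭ runs m′
runs-insert zero    []      = 1 ∷ [] , refl
runs-insert zero    (e ∷ m) = suc e ∷ m , refl
runs-insert (suc i) []      with m′ , p ← runs-insert i [] = 0 ∷ m′ , map⁺-↭ suc p
runs-insert (suc i) (e ∷ m) with m′ , p ← runs-insert i m =
  e ∷ m′ , trans (↭-sym (shift (suc i) (replicate e 0) (map suc (runs m))))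
                 (++⁺ˡ (replicate e 0) (map⁺-↭ suc p))

content : ∀ w → ∃[ m ] w ↭ runs m
content []      = [] , refl
content (i ∷ w) with m , p ← content w with m′ , q ← runs-insert i m = m′ , trans (prep i p) q

-- Arrangements

firstLetters-sound : ∀ m {i m′} → (i , m′) ∈ firstLetters m → i ∷ runs m′ ↭ runs m
firstLetters-sound (zero ∷ m) f∈ with _ , f∈′ , refl ← ∈-map⁻ _ f∈ =
  map⁺-↭ suc (firstLetters-sound m f∈′)
firstLetters-sound (suc e ∷ m) (here refl) = refl
firstLetters-sound (suc e ∷ m) (there f∈) with (i , m′) , f∈′ , refl ← ∈-map⁻ _ f∈ =
  trans (↭-sym (shift (suc i) (replicate (suc e) 0) (map suc (runs m′))))
        (++⁺ˡ (replicate (suc e) 0) (map⁺-↭ suc (firstLetters-sound m f∈′)))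

firstLetters-complete : ∀ m {i} → i ∈ runs m → ∃[ m′ ] (i , m′) ∈ firstLetters m
firstLetters-complete (zero ∷ m) i∈ with _ , i∈′ , refl ← ∈-map⁻ suc i∈ =
  let m′ , f∈ = firstLetters-complete m i∈′ in zero ∷ m′ , ∈-map⁺ _ f∈
firstLetters-complete (suc e ∷ m) (here refl) = e ∷ m , here refl
firstLetters-complete (suc e ∷ m) (there i∈) with ∈-++⁻ (replicate e 0) i∈
... | inj₁ i∈0 with refl ← All.lookup (All.replicate⁺ {P = _≡ 0} e refl) i∈0 = e ∷ m , here refl
... | inj₂ i∈m with _ , i∈′ , refl ← ∈-map⁻ suc i∈m =
  let m′ , f∈ = firstLetters-complete m i∈′ in suc e ∷ m′ , there (∈-map⁺ _ f∈)

firstLetters-length : ∀ m {i m′} → (i , m′) ∈ firstLetters m → length m′ ≡ length m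
firstLetters-length (zero ∷ m) f∈ with _ , f∈′ , refl ← ∈-map⁻ _ f∈ =
  cong suc (firstLetters-length m f∈′)
firstLetters-length (suc e ∷ m) (here refl) = refl
firstLetters-length (suc e ∷ m) (there f∈) with _ , f∈′ , refl ← ∈-map⁻ _ f∈ =
  cong suc (firstLetters-length m f∈′)

firstLetters-unique : ∀ m → Unique (firstLetters m)
firstLetters-unique []          = []
firstLetters-unique (zero ∷ m)  = Unique.map⁺ (λ { refl → refl }) (firstLetters-unique m)
firstLetters-unique (suc e ∷ m) =
  All.map⁺ (All.universal (λ _ ()) (firstLetters m))
  ∷ Unique.map⁺ (λ { refl → refl }) (firstLetters-unique m)

-- The degree must be right: `arrangements zero m` contains the empty word for every `m`.
∈-arrangements⁻ : ∀ d m {w} → length (runs m) ≡ d → w ∈ arrangements d m → w ↭ runs m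
∈-arrangements⁻ zero m len (here refl) with runs m
... | [] = refl
∈-arrangements⁻ (suc d) m len w∈
  with (i , m′) , f∈ , w∈′ ← ∈-concatMap⁻′ _ (firstLetters m) w∈
  with w′ , w′∈ , refl ← ∈-map⁻ (i ∷_) w∈′ =
  trans (prep i (∈-arrangements⁻ d m′
    (ℕ.suc-injective (≡-trans (↭-length (firstLetters-sound m f∈)) len)) w′∈))
    (firstLetters-sound m f∈)

∈-arrangements⁺ : ∀ m {w} → w ↭ runs m → w ∈ arrangements (length w) m
∈-arrangements⁺ m {[]}    p = here refl
∈-arrangements⁺ m {i ∷ w} p with m′ , f∈ ← firstLetters-complete m (∈-resp-↭ p (here refl)) =
  ∈-concatMap⁺′ f∈ (∈-map⁺ (i ∷_)
    (∈-arrangements⁺ m′ (drop-∷ (trans p (↭-sym (firstLetters-sound m f∈))))))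

-- A word fixes its first letter and the content of the remainder. Removing a letter keeps the
-- length of the exponent list, so `runs-injective` recovers the remaining monomial as well.
arrangements-unique : ∀ d m → Unique (arrangements d m)
arrangements-unique zero    m = [] ∷ []
arrangements-unique (suc d) m = unique-concatMap (firstLetters-unique m)
  (λ {(i , m′)} _ → Unique.map⁺ (λ { refl → refl }) (arrangements-unique d m′)) same
  where
  same : ∀ {x x′ w} → x ∈ firstLetters m → x′ ∈ firstLetters m →
    w ∈ map (proj₁ x ∷_) (arrangements d (proj₂ x)) →
    w ∈ map (proj₁ x′ ∷_) (arrangements d (proj₂ x′)) → x ≡ x′
  same {i , m₁} {i′ , m₂} f₁∈ f₂∈ w∈₁ w∈₂
    with _ , _ , refl ← ∈-map⁻ (i ∷_) w∈₁ with _ , _ , refl ← ∈-map⁻ (i′ ∷_) w∈₂ =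
    cong (i ,_) (runs-injective m₁ m₂
      (≡-trans (firstLetters-length m f₁∈) (sym (firstLetters-length m f₂∈)))
      (drop-∷ (trans (firstLetters-sound m f₁∈) (↭-sym (firstLetters-sound m f₂∈)))))

arr : Monomial → List Word
arr m = arrangements (sum m) m

arr-unique : ∀ m → Unique (arr m)
arr-unique m = arrangements-unique (sum m) m

∈-arr⁻ : ∀ m {w} → w ∈ arr m → w ↭ runs m
∈-arr⁻ m = ∈-arrangements⁻ (sum m) m (length-runs m)

∈-arr⁺ : ∀ m {w} → w ↭ runs m → w ∈ arr m
∈-arr⁺ m {w} p =
  subst (λ d → w ∈ arrangements d m) (≡-trans (↭-length p) (length-runs m)) (∈-arrangements⁺ m p)

arr-length : ∀ m {w} → w ∈ arr m → length w ≡ sum m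
arr-length m w∈ = ≡-trans (↭-length (∈-arr⁻ m w∈)) (length-runs m)

card-arr>0 : ∀ m → 0ℚ < card (arr m)
card-arr>0 m = card>0 (∈-arr⁺ m refl)

-- Factorisations

factorisations-length : ∀ m {a b} → (a , b) ∈ factorisations m →
  length a ≡ length m × length b ≡ length m
factorisations-length []      (here refl) = refl , refl
factorisations-length (e ∷ m) f∈
  with _ , _ , _ , f∈′ , refl ← ∈-cartesianProductWith⁻ _ (upTo (suc e)) (factorisations m) f∈
  with eq₁ , eq₂ ← factorisations-length m f∈′ = cong suc eq₁ , cong suc eq₂

factorisations-unique : ∀ m → Unique (factorisations m)
factorisations-unique []      = [] ∷ []
factorisations-unique (e ∷ m) = Unique.cartesianProductWith⁺ _ injective
  (Unique.upTo⁺ (suc e)) (factorisations-unique m)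
  where
  injective : ∀ {i i′} {p p′ : Monomial × Monomial} →
    (i ∷ proj₁ p , (e ∸ i) ∷ proj₂ p) ≡ (i′ ∷ proj₁ p′ , (e ∸ i′) ∷ proj₂ p′) → i ≡ i′ × p ≡ p′
  injective eq with eq₁ , eq₂ ← ,-injective eq =
    proj₁ (∷-injective eq₁) , cong₂ _,_ (proj₂ (∷-injective eq₁)) (proj₂ (∷-injective eq₂))

++-interchange : (as bs cs ds : List A) → (as ++ bs) ++ (cs ++ ds) ↭ (as ++ cs) ++ (bs ++ ds)
++-interchange = interchange
  where open CommutativeSemigroup (CommutativeMonoid.commutativeSemigroup ++-commutativeMonoid)

factorisations-sound : ∀ m {a b} → (a , b) ∈ factorisations m → runs a ++ runs b ↭ runs m
factorisations-sound []      (here refl) = refl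
factorisations-sound (e ∷ m) f∈
  with i , (a , b) , i∈ , f∈′ , refl ←
    ∈-cartesianProductWith⁻ _ (upTo (suc e)) (factorisations m) f∈ =
  trans (++-interchange (replicate i 0) _ _ _)
    (++⁺ (↭-reflexive (≡-trans (replicate-++ i (e ∸ i))
                               (cong (λ k → replicate k 0) (ℕ.m+[n∸m]≡n (ℕ.≤-pred (∈-upTo⁻ i∈))))))
         (trans (↭-reflexive (sym (map-++ suc (runs a) (runs b))))
                (map⁺-↭ suc (factorisations-sound m f∈′))))
  where
  replicate-++ : ∀ i j → replicate i 0 ++ replicate j 0 ≡ replicate (i ℕ.+ j) 0
  replicate-++ zero    j = refl
  replicate-++ (suc i) j = cong (0 ∷_) (replicate-++ i j)

factorisations-complete : ∀ m v w → v ++ w ↭ runs m →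
  ∃[ a ] ∃[ b ] (a , b) ∈ factorisations m × v ↭ runs a × w ↭ runs b
factorisations-complete [] []      []      p = [] , [] , here refl , refl , refl
factorisations-complete [] []      (_ ∷ _) p = ⊥-elim (¬x∷xs↭[] p)
factorisations-complete [] (_ ∷ _) w       p = ⊥-elim (¬x∷xs↭[] p)
factorisations-complete (e ∷ m) v w p
  with a , b , f∈ , p₁ , p₂ ← factorisations-complete m (lowered v) (lowered w)
    (trans (↭-reflexive (sym (mapMaybe-++ lower v w)))
           (trans (mapMaybe-↭ lower p) (↭-reflexive (lowered-runs e m))))
  -- The zeros are shared out between `v` and `w`. Their total is `e`, so the truncated difference
  -- is the number of zeros of `w`.
  = zeros v ∷ a , (e ∸ zeros v) ∷ b , ∈-cartesianProductWith⁺ _ (∈-upTo⁺ (s≤s zeros-v≤e)) f∈ ,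
    trans (decomposition v) (++⁺ˡ (replicate (zeros v) 0) (map⁺-↭ suc p₁)) ,
    trans (decomposition w) (trans (++⁺ˡ (replicate (zeros w) 0) (map⁺-↭ suc p₂))
      (↭-reflexive (cong (λ j → runs (j ∷ b)) (sym e∸zeros-v≡zeros-w))))
  where
  zeros-+ : zeros v ℕ.+ zeros w ≡ e
  zeros-+ = ≡-trans (sym (zeros-++ v w)) (≡-trans (zeros-↭ p) (zeros-runs e m))
  zeros-v≤e : zeros v ℕ.≤ e
  zeros-v≤e = ℕ.≤-trans (ℕ.m≤m+n (zeros v) (zeros w)) (ℕ.≤-reflexive zeros-+)
  e∸zeros-v≡zeros-w : e ∸ zeros v ≡ zeros w
  e∸zeros-v≡zeros-w = ≡-trans (cong (_∸ zeros v) (sym zeros-+)) (ℕ.m+n∸m≡n (zeros v) (zeros w))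

take-++-length : (xs ys : List A) → take (length xs) (xs ++ ys) ≡ xs
take-++-length []       ys = refl
take-++-length (x ∷ xs) ys = cong (x ∷_) (take-++-length xs ys)

drop-++-length : (xs ys : List A) → drop (length xs) (xs ++ ys) ≡ ys
drop-++-length []       ys = refl
drop-++-length (x ∷ xs) ys = drop-++-length xs ys

-- Cutting at position `k` matches the arrangements of `m` with pairs of arrangements of two
-- factors, the first of degree `k`; this turns concatenation of words into the product of series.
-- Words that are too short and factors of another degree contribute 0 by the condition on `h`.
∑-arr-split : ∀ k m (h : Word → Word → ℚ) → (∀ v w → length v ≢ k → h v w ≡ 0ℚ) →
  ∑ (arr m) (λ w → h (take k w) (drop k w)) ≡
  ∑ (factorisations m) (λ (a , b) → ∑ (arr a) (λ v → ∑ (arr b) (h v)))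
∑-arr-split k m h h≡0 = begin
  ∑ (arr m) (λ w → h (take k w) (drop k w))
    ≡⟨ ∑-filter long? (arr m) (λ {w} _ short → h≡0 (take k w) (drop k w) short) ⟨
  ∑ (filter long? (arr m)) (λ w → h (take k w) (drop k w))
    ≡⟨ ∑-bijection (Unique.filter⁺ long? (arr-unique m)) (Unique.filter⁺ fits? pairs!)
         (λ w → take k w , drop k w) (λ (v , w) → v ++ w)
         (λ {w} w∈ → let w∈m , len = ∈-filter⁻ long? w∈ in ∈-filter⁺ fits?
           (∈-pairs⁺ (trans (↭-reflexive (take++drop≡id k w)) (∈-arr⁻ m w∈m))) len)
         (λ {(v , w)} vw∈ → let vw∈m , len = ∈-filter⁻ fits? {xs = pairs} vw∈ in
           ∈-filter⁺ long? (∈-arr⁺ m (∈-pairs⁻ vw∈m))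
             (≡-trans (cong length (take-++ v w len)) len))
         (λ {w} _ → take++drop≡id k w)
         (λ {(v , w)} vw∈ → let _ , len = ∈-filter⁻ fits? {xs = pairs} vw∈ in
           cong₂ _,_ (take-++ v w len) (drop-++ v w len))
         (λ _ → refl) ⟩
  ∑ (filter fits? pairs) (uncurry h)
    ≡⟨ ∑-filter fits? pairs (λ {(v , w)} _ len → h≡0 v w len) ⟩
  ∑ pairs (uncurry h)
    ≡⟨ ∑-concatMap (λ (a , b) → cartesianProduct (arr a) (arr b)) (factorisations m) (uncurry h) ⟩
  ∑ (factorisations m) (λ (a , b) → ∑ (cartesianProduct (arr a) (arr b)) (uncurry h))
    ≡⟨ ∑-cong (factorisations m) (λ {(a , b)} _ →
         ∑-cartesianProduct (arr a) (arr b) (uncurry h)) ⟩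
  ∑ (factorisations m) (λ (a , b) → ∑ (arr a) (λ v → ∑ (arr b) (h v))) ∎
  where
  long? : Decidable (λ w → length (take k w) ≡ k)
  long? w = length (take k w) ≟ k

  fits? : Decidable {A = Word × Word} (λ (v , w) → length v ≡ k)
  fits? (v , w) = length v ≟ k

  take-++ : ∀ (v w : Word) → length v ≡ k → take k (v ++ w) ≡ v
  take-++ v w refl = take-++-length v w

  drop-++ : ∀ (v w : Word) → length v ≡ k → drop k (v ++ w) ≡ w
  drop-++ v w refl = drop-++-length v w

  pairs : List (Word × Word)
  pairs = concatMap (λ (a , b) → cartesianProduct (arr a) (arr b)) (factorisations m)

  ∈-pairs⁺ : ∀ {v w} → v ++ w ↭ runs m → (v , w) ∈ pairs
  ∈-pairs⁺ {v} {w} p with a , b , f∈ , p₁ , p₂ ← factorisations-complete m v w p =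
    ∈-concatMap⁺′ f∈ (∈-cartesianProduct⁺ (∈-arr⁺ a p₁) (∈-arr⁺ b p₂))

  ∈-pairs⁻ : ∀ {v w} → (v , w) ∈ pairs → v ++ w ↭ runs m
  ∈-pairs⁻ vw∈ with (a , b) , f∈ , vw∈′ ← ∈-concatMap⁻′ _ (factorisations m) vw∈
    with v∈ , w∈ ← ∈-cartesianProduct⁻ (arr a) (arr b) vw∈′ =
    trans (++⁺ (∈-arr⁻ a v∈) (∈-arr⁻ b w∈)) (factorisations-sound m f∈)

  -- The words of a pair determine both factors, because the exponent lists of these are as long as
  -- `m`.
  pairs! : Unique pairs
  pairs! = unique-concatMap (factorisations-unique m)
    (λ {(a , b)} _ → Unique.cartesianProduct⁺ (arr-unique a) (arr-unique b)) same
    where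
    same : ∀ {p p′ : Monomial × Monomial} {vw} → p ∈ factorisations m → p′ ∈ factorisations m →
      vw ∈ cartesianProduct (arr (proj₁ p)) (arr (proj₂ p)) →
      vw ∈ cartesianProduct (arr (proj₁ p′)) (arr (proj₂ p′)) → p ≡ p′
    same {a , b} {a′ , b′} f∈ f′∈ vw∈ vw∈′
      with v∈ , w∈ ← ∈-cartesianProduct⁻ (arr a) (arr b) vw∈
      with v∈′ , w∈′ ← ∈-cartesianProduct⁻ (arr a′) (arr b′) vw∈′
      with eqa , eqb ← factorisations-length m f∈ with eqa′ , eqb′ ← factorisations-length m f′∈ =
      cong₂ _,_
        (runs-injective a a′ (≡-trans eqa (sym eqa′)) (trans (↭-sym (∈-arr⁻ a v∈)) (∈-arr⁻ a′ v∈′)))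
        (runs-injective b b′ (≡-trans eqb (sym eqb′)) (trans (↭-sym (∈-arr⁻ b w∈)) (∈-arr⁻ b′ w∈′)))

-- Applied to xs itself, act p yields ys; for every bs it only permutes the entries of bs.
act : xs ↭ ys → List B → List B
act refl          bs           = bs
act (prep _ p)    []           = []
act (prep _ p)    (b ∷ bs)     = b ∷ act p bs
act (swap _ _ p)  []           = []
act (swap _ _ p)  (b ∷ [])     = b ∷ []
act (swap _ _ p)  (b ∷ c ∷ bs) = c ∷ b ∷ act p bs
act (trans p q)   bs           = act q (act p bs)

act-↭ : (p : xs ↭ ys) (bs : List B) → act p bs ↭ bs
act-↭ refl         bs           = refl
act-↭ (prep _ p)   []           = refl
act-↭ (prep _ p)   (b ∷ bs)     = prep b (act-↭ p bs)
act-↭ (swap _ _ p) []           = refl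
act-↭ (swap _ _ p) (b ∷ [])     = refl
act-↭ (swap _ _ p) (b ∷ c ∷ bs) = swap c b (act-↭ p bs)
act-↭ (trans p q)  bs           = trans (act-↭ q (act p bs)) (act-↭ p bs)

act-sym-act : (p : xs ↭ ys) (bs : List B) → act (↭-sym p) (act p bs) ≡ bs
act-sym-act refl         bs           = refl
act-sym-act (prep _ p)   []           = refl
act-sym-act (prep _ p)   (b ∷ bs)     = cong (b ∷_) (act-sym-act p bs)
act-sym-act (swap _ _ p) []           = refl
act-sym-act (swap _ _ p) (b ∷ [])     = refl
act-sym-act (swap _ _ p) (b ∷ c ∷ bs) = cong (λ bs → b ∷ c ∷ bs) (act-sym-act p bs)
act-sym-act (trans p q)  bs           =
  ≡-trans (cong (act (↭-sym p)) (act-sym-act q (act p bs))) (act-sym-act p bs)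

act-act-sym : (p : xs ↭ ys) (bs : List B) → act p (act (↭-sym p) bs) ≡ bs
act-act-sym p bs = subst (λ q → act q (act (↭-sym p) bs) ≡ bs) (↭-sym-involutive p)
  (act-sym-act (↭-sym p) bs)

-- This is the purpose of `act`: the same positions move in both lists, so the pairs stay together.
-- Equal lengths exclude the clauses in which `act` runs out of entries.
zip-act : (p : xs ↭ ys) (bs : List B) → length bs ≡ length xs → zip xs bs ↭ zip ys (act p bs)
zip-act refl         bs           eq = refl
zip-act (prep x p)   (b ∷ bs)     eq = prep (x , b) (zip-act p bs (ℕ.suc-injective eq))
zip-act (swap x y p) (b ∷ c ∷ bs) eq =
  swap (x , b) (y , c) (zip-act p bs (ℕ.suc-injective (ℕ.suc-injective eq)))
zip-act (trans p q)  bs           eq = trans (zip-act p bs eq)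
  (zip-act q (act p bs) (≡-trans (↭-length (act-↭ p bs)) (≡-trans eq (↭-length p))))

-- Words read along a labelling of their positions

-- Positions with equal labels carry different letters. The lengths are compared separately because
-- `zip` drops the surplus of the longer list.
Compatible : Word → Word → Set
Compatible b w = length b ≡ length w × Unique (zip b w)

compatible? : ∀ b w → Dec (Compatible b w)
compatible? b w = (length b ≟ length w) ×-dec DecUnique.unique? (×-≡-dec _≟_ _≟_) (zip b w)

compatible-sym : ∀ {b w} → Compatible b w → Compatible w b
compatible-sym {b} {w} (eq , u) =
  sym eq , subst Unique (sym (zip-flip w b)) (Unique.map⁺ (λ { refl → refl }) u)

compatible-act : ∀ {b b′ w} (p : b ↭ b′) → Compatible b w → Compatible b′ (act p w)
compatible-act {w = w} p (eq , u) =
  ≡-trans (sym (↭-length p)) (≡-trans eq (sym (↭-length (act-↭ p w)))) ,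
  unique-resp-↭ (zip-act p w (sym eq)) u

-- One number with two readings. As a function of `m` it gives the coefficients of ρ e_π for π
-- labelled by `b` (`ρ-eNC`); as a function of the word `b` it gives the coefficients of a sum of
-- e_π over labellings with content `m` (`fillings-eNC`).
fillings : Word → Monomial → ℚ
fillings b m = ∑ (arr m) (λ w → indicator (compatible? b w))

-- Moving the letters along with the labels permutes the arrangements of `m` among themselves and
-- keeps compatibility.
fillings-↭ : ∀ {b b′} → b ↭ b′ → ∀ m → fillings b m ≡ fillings b′ m
fillings-↭ {b} {b′} p m = ∑-bijection (arr-unique m) (arr-unique m) (act p) (act (↭-sym p))
  (λ {w} w∈ → ∈-arr⁺ m (trans (act-↭ p w) (∈-arr⁻ m w∈)))
  (λ {w} w∈ → ∈-arr⁺ m (trans (act-↭ (↭-sym p) w) (∈-arr⁻ m w∈)))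
  (λ {w} _ → act-sym-act p w) (λ {w} _ → act-act-sym p w)
  (λ {w} _ → indicator-cong (compatible? b w) (compatible? b′ (act p w)) (compatible-act p)
    (λ c → subst (Compatible b) (act-sym-act p w) (compatible-act (↭-sym p) c)))

zip-block : ∀ (b v w : Word) → zip (replicate (length v) 0 ++ map suc b) (v ++ w) ≡
  map (0 ,_) v ++ map (map₁ suc) (zip b w)
zip-block b []      w = ≡-trans (cong (zip (map suc b)) (sym (map-id w))) (zip-map suc id b w)
zip-block b (j ∷ v) w = cong ((0 , j) ∷_) (zip-block b v w)

-- The new block has label 0 and the other labels are shifted up, so no pair of the block meets a
-- pair of the rest, whatever the letters.
compatible-block⁺ : ∀ {b v w} → Unique v → Compatible b w →
  Compatible (replicate (length v) 0 ++ map suc b) (v ++ w)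
compatible-block⁺ {b} {v} {w} v! (eq , u) = length-eq , subst Unique (sym (zip-block b v w))
  (Unique.++⁺ (Unique.map⁺ (λ { refl → refl }) v!) (Unique.map⁺ (λ { refl → refl }) u) disjoint)
  where
  length-eq : length (replicate (length v) 0 ++ map suc b) ≡ length (v ++ w)
  length-eq = begin
    length (replicate (length v) 0 ++ map suc b)
      ≡⟨ length-++ (replicate (length v) 0) ⟩
    length (replicate (length v) 0) ℕ.+ length (map suc b)
      ≡⟨ cong₂ ℕ._+_ (length-replicate (length v)) (≡-trans (length-map suc b) eq) ⟩
    length v ℕ.+ length w                                     ≡⟨ length-++ v ⟨
    length (v ++ w)                                           ∎
  disjoint : ∀ {ij} → ¬ (ij ∈ map (0 ,_) v × ij ∈ map (map₁ suc) (zip b w))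
  disjoint (∈₁ , ∈₂) with _ , _ , refl ← ∈-map⁻ (0 ,_) ∈₁ with _ , _ , () ← ∈-map⁻ (map₁ suc) ∈₂

compatible-block⁻ : ∀ {b v w} → Compatible (replicate (length v) 0 ++ map suc b) (v ++ w) →
  Unique v × Compatible b w
compatible-block⁻ {b} {v} {w} (eq , u)
  with u₁ , u₂ ← unique-++⁻ (map (0 ,_) v) (subst Unique (zip-block b v w) u) =
  Unique.map⁻ u₁ , length-eq , Unique.map⁻ u₂
  where
  length-eq : length b ≡ length w
  length-eq = ℕ.+-cancelˡ-≡ (length v) (length b) (length w) (begin
    length v ℕ.+ length b
      ≡⟨ cong₂ ℕ._+_ (length-replicate (length v)) (length-map suc b) ⟨
    length (replicate (length v) 0) ℕ.+ length (map suc b)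
      ≡⟨ length-++ (replicate (length v) 0) ⟨
    length (replicate (length v) 0 ++ map suc b)              ≡⟨ eq ⟩
    length (v ++ w)                                           ≡⟨ length-++ v ⟩
    length v ℕ.+ length w                                     ∎)

-- Counting fillings by factorials and elementary symmetric functions

fromℕ : ℕ → ℚ
fromℕ zero    = 0ℚ
fromℕ (suc n) = 1ℚ + fromℕ n

card≡length : (xs : List A) → card xs ≡ fromℕ (length xs)
card≡length []       = refl
card≡length (x ∷ xs) = cong (1ℚ +_) (card≡length xs)

fromℕ-suc>0 : ∀ n → 0ℚ < fromℕ (suc n)
fromℕ-suc>0 n = subst (0ℚ <_) (≡-trans (card≡length (replicate (suc n) n))
  (cong fromℕ (length-replicate (suc n)))) (card>0 {xs = replicate (suc n) n} (here refl))

factorial : ℕ → ℚ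
factorial zero    = 1ℚ
factorial (suc k) = fromℕ (suc k) * factorial k

factorial>0 : ∀ k → 0ℚ < factorial k
factorial>0 zero    = ℚ.positive⁻¹ 1ℚ
factorial>0 (suc k) = pos*pos (fromℕ-suc>0 k) (factorial>0 k)

runs-unique : All (ℕ._≤ 1) m → Unique (runs m)
runs-unique []                            = []
runs-unique {zero ∷ m}        (_ ∷ m≤1) = Unique.map⁺ ℕ.suc-injective (runs-unique m≤1)
runs-unique {suc zero ∷ m}    (_ ∷ m≤1) =
  All.map⁺ (All.universal (λ _ ()) (runs m)) ∷ Unique.map⁺ ℕ.suc-injective (runs-unique m≤1)
runs-unique {suc (suc _) ∷ m} (s≤s () ∷ _)

runs-unique⁻ : ∀ m → Unique (runs m) → All (ℕ._≤ 1) m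
runs-unique⁻ []                _               = []
runs-unique⁻ (zero ∷ m)        u               = z≤n ∷ runs-unique⁻ m (Unique.map⁻ u)
runs-unique⁻ (suc zero ∷ m)    (_ ∷ u)         = s≤s z≤n ∷ runs-unique⁻ m (Unique.map⁻ u)
runs-unique⁻ (suc (suc e) ∷ m) ((0≢0 ∷ _) ∷ _) = ⊥-elim (0≢0 refl)

length-firstLetters : All (ℕ._≤ 1) m → length (firstLetters m) ≡ sum m
length-firstLetters []                           = refl
length-firstLetters {zero ∷ m}        (_ ∷ m≤1) =
  ≡-trans (length-map _ (firstLetters m)) (length-firstLetters m≤1)
length-firstLetters {suc zero ∷ m}    (_ ∷ m≤1) =
  cong suc (≡-trans (length-map _ (firstLetters m)) (length-firstLetters m≤1))
length-firstLetters {suc (suc _) ∷ m} (s≤s () ∷ _)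

-- A squarefree monomial has as many first letters as its degree, and removing one leaves a
-- squarefree monomial of degree one less.
card-arrangements : ∀ d m → All (ℕ._≤ 1) m → sum m ≡ d → card (arrangements d m) ≡ factorial d
card-arrangements zero    m m≤1 eq = +-identityʳ 1ℚ
card-arrangements (suc d) m m≤1 eq = begin
  ∑ (arrangements (suc d) m) (λ _ → 1ℚ)
    ≡⟨ ∑-concatMap _ (firstLetters m) (λ _ → 1ℚ) ⟩
  ∑ (firstLetters m) (λ (i , m′) → card (map (i ∷_) (arrangements d m′)))
    ≡⟨ ∑-const (firstLetters m) (λ {(i , m′)} f∈ →
         ≡-trans (∑-map (i ∷_) (arrangements d m′) (λ _ → 1ℚ))
                 (card-arrangements d m′ (m′≤1 f∈) (sum-m′ f∈))) ⟩
  card (firstLetters m) * factorial d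
    ≡⟨ cong (_* factorial d) (≡-trans (card≡length (firstLetters m))
         (cong fromℕ (≡-trans (length-firstLetters m≤1) eq))) ⟩
  fromℕ (suc d) * factorial d ∎
  where
  m′≤1 : ∀ {i m′} → (i , m′) ∈ firstLetters m → All (ℕ._≤ 1) m′
  m′≤1 {m′ = m′} f∈ with _ ∷ u ←
    unique-resp-↭ (↭-sym (firstLetters-sound m f∈)) (runs-unique m≤1) = runs-unique⁻ m′ u
  sum-m′ : ∀ {i m′} → (i , m′) ∈ firstLetters m → sum m′ ≡ d
  sum-m′ {m′ = m′} f∈ = ≡-trans (sym (length-runs m′)) (ℕ.suc-injective
    (≡-trans (↭-length (firstLetters-sound m f∈)) (≡-trans (length-runs m) eq)))

injective? : ∀ k v → Dec (length v ≡ k × Unique v)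
injective? k v = (length v ≟ k) ×-dec DecUnique.unique? _≟_ v

-- The one-block case ρ e_⟦k⟧ = k! e_k: words without repetition are precisely the arrangements of
-- squarefree monomials, and each such monomial of degree `k` has k! of them.
∑-arr-injective : ∀ k m →
  ∑ (arr m) (λ v → indicator (injective? k v)) ≡ factorial k * coeff (elementary k) m
∑-arr-injective k m with squarefree? m ×-dec (sum m ≟ k) in eq
... | yes (m≤1 , refl) = begin
  ∑ (arr m) (λ v → indicator (injective? k v))
    ≡⟨ ∑-const (arr m) (λ {v} v∈ → indicator-yes (injective? k v)
         (arr-length m v∈ , unique-resp-↭ (↭-sym (∈-arr⁻ m v∈)) (runs-unique m≤1))) ⟩
  card (arr m) * 1ℚ
    ≡⟨ cong₂ _*_ (card-arrangements (sum m) m m≤1 refl) (cong indicator (sym eq)) ⟩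
  factorial k * coeff (elementary k) m ∎
... | no ¬elementary = begin
  ∑ (arr m) (λ v → indicator (injective? k v))
    ≡⟨ ∑-cong (arr m) (λ {v} v∈ → indicator-no (injective? k v) λ (len , v!) →
         ¬elementary (runs-unique⁻ m (unique-resp-↭ (∈-arr⁻ m v∈) v!) ,
                      ≡-trans (sym (arr-length m v∈)) len)) ⟩
  ∑ (arr m) (λ _ → 0ℚ) ≡⟨ ∑-zero (arr m) ⟩
  0ℚ                   ≡⟨ *-zeroʳ (factorial k) ⟨
  factorial k * 0ℚ     ≡⟨ cong (λ d → factorial k * indicator d) (sym eq) ⟩
  factorial k * coeff (elementary k) m ∎

factorials : List ℕ → ℚ
factorials = foldr (λ k q → factorial k * q) 1ℚ

factorials>0 : ∀ ks → 0ℚ < factorials ks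
factorials>0 []       = ℚ.positive⁻¹ 1ℚ
factorials>0 (k ∷ ks) = pos*pos (factorial>0 k) (factorials>0 ks)

-- The body of `eSym` on a bare list, so that an induction can remove a part without rebuilding an
-- `IntegerPartition`.
elementaries : List ℕ → Series
elementaries = foldr (λ k f → elementary k · f) one

-- A compatible word splits after `k` letters into a repetition-free word for the block labelled 0
-- and a word compatible with the remaining labels. `∑-arr-split` turns this splitting into the
-- product of series.
fillings-runs : ∀ ks m → fillings (runs ks) m ≡ factorials ks * coeff (elementaries ks) m
fillings-runs [] m = ≡-trans (helper (sum m ≟ 0)) (sym (*-identityˡ _))
  where
  helper : (d : Dec (sum m ≡ 0)) → fillings [] m ≡ indicator d
  -- In degree 0 the empty word is the only arrangement.
  helper (yes eq) rewrite eq = refl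
  helper (no neq) = ≡-trans (∑-cong (arr m) (λ {w} w∈ → indicator-no (compatible? [] w)
    λ (eq , _) → neq (≡-trans (sym (arr-length m w∈)) (sym eq)))) (∑-zero (arr m))
fillings-runs (k ∷ ks) m = begin
  ∑ (arr m) (λ w → indicator (compatible? (runs (k ∷ ks)) w))
    ≡⟨ ∑-cong (arr m) (λ {w} _ → split w) ⟩
  ∑ (arr m) (λ w → h (take k w) (drop k w))
    ≡⟨ ∑-arr-split k m h (λ v w len → ≡-trans
         (cong (_* indicator (compatible? (runs ks) w))
               (indicator-no (injective? k v) (len ∘ proj₁)))
         (*-zeroˡ (indicator (compatible? (runs ks) w)))) ⟩
  ∑ (factorisations m) (λ (a , b) → ∑ (arr a) (λ v → ∑ (arr b) (h v)))
    ≡⟨ ∑-cong (factorisations m) (λ {(a , b)} _ → factor a b) ⟩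
  ∑ (factorisations m) (λ (a , b) →
    factorials (k ∷ ks) * (coeff (elementary k) a * coeff (elementaries ks) b))
    ≡⟨ ∑-*ˡ (factorials (k ∷ ks)) (factorisations m) _ ⟩
  factorials (k ∷ ks) * coeff (elementaries (k ∷ ks)) m ∎
  where
  h : Word → Word → ℚ
  h v w = indicator (injective? k v) * indicator (compatible? (runs ks) w)

  split : ∀ w → indicator (compatible? (runs (k ∷ ks)) w) ≡ h (take k w) (drop k w)
  split w = ≡-trans
    (indicator-cong (compatible? (runs (k ∷ ks)) w)
      (injective? k (take k w) ×-dec compatible? (runs ks) (drop k w)) separate combine)
    (indicator-× (injective? k (take k w)) (compatible? (runs ks) (drop k w)))
    where
    separate : Compatible (runs (k ∷ ks)) w →
      (length (take k w) ≡ k × Unique (take k w)) × Compatible (runs ks) (drop k w)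
    separate c =
      let v! , c′ = compatible-block⁻ {v = take k w} (subst₂ Compatible
            (cong (λ l → runs (l ∷ ks)) (sym len)) (sym (take++drop≡id k w)) c)
      in (len , v!) , c′
      where
      -- Otherwise `take k w` would be shorter than `k`; the equal lengths in compatibility exclude
      -- this.
      k≤length : k ℕ.≤ length w
      k≤length = ℕ.≤-trans (ℕ.m≤m+n k (sum ks))
        (ℕ.≤-reflexive (≡-trans (sym (length-runs (k ∷ ks))) (proj₁ c)))
      len : length (take k w) ≡ k
      len = ≡-trans (length-take k w) (ℕ.m≤n⇒m⊓n≡m k≤length)
    combine : (length (take k w) ≡ k × Unique (take k w)) × Compatible (runs ks) (drop k w) →
      Compatible (runs (k ∷ ks)) w
    combine ((len , v!) , c) = subst₂ Compatible
      (cong (λ l → runs (l ∷ ks)) len) (take++drop≡id k w) (compatible-block⁺ v! c)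

  factor : ∀ a b → ∑ (arr a) (λ v → ∑ (arr b) (h v)) ≡
    factorials (k ∷ ks) * (coeff (elementary k) a * coeff (elementaries ks) b)
  factor a b = begin
    ∑ (arr a) (λ v → ∑ (arr b) (h v))
      ≡⟨ ∑-cong (arr a) (λ {v} _ → ∑-*ˡ (indicator (injective? k v)) (arr b) _) ⟩
    ∑ (arr a) (λ v → indicator (injective? k v) * fillings (runs ks) b)
      ≡⟨ ∑-*ʳ (fillings (runs ks) b) (arr a) _ ⟩
    ∑ (arr a) (λ v → indicator (injective? k v)) * fillings (runs ks) b
      ≡⟨ cong₂ _*_ (∑-arr-injective k a) (fillings-runs ks b) ⟩
    factorial k * coeff (elementary k) a * (factorials ks * coeff (elementaries ks) b)
      ≡⟨ *.interchange (factorial k) _ (factorials ks) _ ⟩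
    factorials (k ∷ ks) * (coeff (elementary k) a * coeff (elementaries ks) b) ∎

-- Double counting the compatible pairs of an arrangement of m and one of m′.
fillings-symmetric : ∀ {w m} → w ↭ runs m → ∀ m′ →
  card (arr m) * fillings w m′ ≡ card (arr m′) * fillings (runs m′) m
fillings-symmetric {w} {m} p m′ = begin
  card (arr m) * fillings w m′
    ≡⟨ ∑-const (arr m) (λ v∈ → fillings-↭ (trans (∈-arr⁻ m v∈) (↭-sym p)) m′) ⟨
  ∑ (arr m) (λ v → ∑ (arr m′) (λ b → indicator (compatible? v b)))
    ≡⟨ ∑-swap (arr m) (arr m′) _ ⟩
  ∑ (arr m′) (λ b → ∑ (arr m) (λ v → indicator (compatible? v b)))
    ≡⟨ ∑-cong (arr m′) (λ {b} _ → ∑-cong (arr m) (λ {v} _ →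
         indicator-cong (compatible? v b) (compatible? b v) compatible-sym compatible-sym)) ⟩
  ∑ (arr m′) (λ b → fillings b m)
    ≡⟨ ∑-const (arr m′) (λ b∈ → fillings-↭ (∈-arr⁻ m′ b∈) m) ⟩
  card (arr m′) * fillings (runs m′) m ∎

-- Tabulated lists and sublists

unique-tabulate⁻ : {f : Fin n → A} → Unique (tabulate f) → ∀ {i j} → f i ≡ f j → i ≡ j
unique-tabulate⁻ u       {Fin.zero}  {Fin.zero}  eq = refl
unique-tabulate⁻ (z ∷ _) {Fin.zero}  {Fin.suc j} eq = ⊥-elim (All.tabulate⁻ z j eq)
unique-tabulate⁻ (z ∷ _) {Fin.suc i} {Fin.zero}  eq = ⊥-elim (All.tabulate⁻ z i (sym eq))
unique-tabulate⁻ (_ ∷ u) {Fin.suc i} {Fin.suc j} eq = cong Fin.suc (unique-tabulate⁻ u eq)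

tabulate-injective : {f g : Fin n → A} → tabulate f ≡ tabulate g → ∀ i → f i ≡ g i
tabulate-injective eq Fin.zero    = proj₁ (∷-injective eq)
tabulate-injective eq (Fin.suc i) = tabulate-injective (proj₂ (∷-injective eq)) i

tabulation : (xs : List A) → length xs ≡ n → ∃[ f ] xs ≡ tabulate {n = n} f
tabulation xs refl = lookup xs , sym (tabulate-lookup xs)

zip-tabulate : (w : List B) (f : Fin (length w) → A) →
  zip (tabulate f) w ≡ tabulate (λ i → f i , lookup w i)
zip-tabulate []      f = refl
zip-tabulate (x ∷ w) f = cong ((f Fin.zero , x) ∷_) (zip-tabulate w (f ∘ Fin.suc))

unique⇒allPairs : ∀ {R : A → A → Set} → (∀ {x y} → x ∈ xs → y ∈ xs → x ≢ y → R x y) →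
  Unique xs → AllPairs R xs
unique⇒allPairs h []           = []
unique⇒allPairs h (x∉xs ∷ xs!) =
  All.tabulate (λ y∈ → h (here refl) (there y∈) (All.lookup x∉xs y∈))
  ∷ unique⇒allPairs (λ p q → h (there p) (there q)) xs!

-- A sublist of a duplicate-free list is determined by its members. This turns equality of sets of
-- blocks into equality of lists.
sublist≡filter : ∀ {P : A → Set} (P? : Decidable P) {xs zs : List A} → xs ⊆ zs → Unique zs →
  (∀ {z} → z ∈ xs → P z) → (∀ {z} → z ∈ zs → P z → z ∈ xs) → xs ≡ filter P? zs
sublist≡filter P? []            zs!          P-xs xs-P = refl
sublist≡filter P? (z ∷ʳ xs⊆zs)  (z∉zs ∷ zs!) P-xs xs-P = ≡-trans
  (sublist≡filter P? xs⊆zs zs! P-xs (xs-P ∘ there))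
  (sym (filter-reject P? λ Pz → All.lookup z∉zs (⊆-lookup xs⊆zs (xs-P (here refl) Pz)) refl))
sublist≡filter P? {x ∷ xs} (refl ∷ xs⊆zs) (x∉zs ∷ zs!) P-xs xs-P = ≡-trans
  (cong (x ∷_) (sublist≡filter P? xs⊆zs zs! (P-xs ∘ there)
    λ z∈zs Pz → tail z∈zs (xs-P (there z∈zs) Pz)))
  (sym (filter-accept P? (P-xs (here refl))))
  where
  tail : ∀ {z} → z ∈ _ → z ∈ x ∷ xs → z ∈ xs
  tail z∈zs (here refl)  = ⊥-elim (All.lookup x∉zs z∈zs refl)
  tail z∈zs (there z∈xs) = z∈xs

-- The list of set partitions

∈-subsets : ∀ {n} (B : Subset n) → B ∈ subsets n
∈-subsets Vec.[]            = here refl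
∈-subsets (true Vec.∷ B)    = ∈-++⁺ˡ (∈-map⁺ (inside Vec.∷_) (∈-subsets B))
∈-subsets (false Vec.∷ B)   = ∈-++⁺ʳ _ (∈-map⁺ (outside Vec.∷_) (∈-subsets B))

subsets-unique : ∀ n → Unique (subsets n)
subsets-unique zero    = [] ∷ []
subsets-unique (suc n) = Unique.++⁺ (Unique.map⁺ Vec.∷-injectiveʳ (subsets-unique n))
  (Unique.map⁺ Vec.∷-injectiveʳ (subsets-unique n)) disjoint
  where
  disjoint : ∀ {B} → ¬ (B ∈ map (inside Vec.∷_) (subsets n) × B ∈ map (outside Vec.∷_) (subsets n))
  disjoint (∈₁ , ∈₂) with _ , _ , refl ← ∈-map⁻ _ ∈₁ with _ , _ , () ← ∈-map⁻ _ ∈₂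

∈-sublists⁺ : xs ⊆ ys → xs ∈ sublists ys
∈-sublists⁺ []           = here refl
∈-sublists⁺ (y ∷ʳ p)     = ∈-++⁺ʳ _ (∈-sublists⁺ p)
∈-sublists⁺ (refl ∷ p)   = ∈-++⁺ˡ (∈-map⁺ _ (∈-sublists⁺ p))

∈-sublists⁻ : ∀ (ys : List A) {xs} → xs ∈ sublists ys → xs ⊆ ys
∈-sublists⁻ []       (here refl) = []
∈-sublists⁻ (y ∷ ys) xs∈ with ∈-++⁻ (map (y ∷_) (sublists ys)) xs∈
... | inj₁ xs∈₁ with _ , xs∈ys , refl ← ∈-map⁻ (y ∷_) xs∈₁ = refl ∷ ∈-sublists⁻ ys xs∈ys
... | inj₂ xs∈₂ = y ∷ʳ ∈-sublists⁻ ys xs∈₂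

sublists-unique : Unique xs → Unique (sublists xs)
sublists-unique []           = [] ∷ []
sublists-unique {xs = x ∷ xs} (x∉xs ∷ xs!) = Unique.++⁺
  (Unique.map⁺ (proj₂ ∘ ∷-injective) (sublists-unique xs!)) (sublists-unique xs!) disjoint
  where
  disjoint : ∀ {zs} → ¬ (zs ∈ map (x ∷_) (sublists xs) × zs ∈ sublists xs)
  disjoint (∈₁ , ∈₂) with _ , _ , refl ← ∈-map⁻ (x ∷_) ∈₁ =
    All.lookup x∉xs (⊆-lookup (∈-sublists⁻ xs ∈₂) (here refl)) refl

∈-mapMaybe⁺ : ∀ (f : A → Maybe B) {x y} → x ∈ xs → f x ≡ just y → y ∈ mapMaybe f xs
∈-mapMaybe⁺ {xs = x ∷ _} f (here refl) eq with f x
∈-mapMaybe⁺ {xs = x ∷ _} f (here refl) refl | just y = here refl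
∈-mapMaybe⁺ {xs = x ∷ _} f (there x∈) eq with f x
... | just _  = there (∈-mapMaybe⁺ f x∈ eq)
... | nothing = ∈-mapMaybe⁺ f x∈ eq

∈-mapMaybe⁻ : ∀ (f : A → Maybe B) xs {y} → y ∈ mapMaybe f xs → ∃[ x ] x ∈ xs × f x ≡ just y
∈-mapMaybe⁻ f (x ∷ xs) y∈ with f x in eq
∈-mapMaybe⁻ f (x ∷ xs) (here refl) | just _ = x , here refl , eq
∈-mapMaybe⁻ f (x ∷ xs) (there y∈)  | just _ with x′ , x′∈ , eq′ ← ∈-mapMaybe⁻ f xs y∈ =
  x′ , there x′∈ , eq′
∈-mapMaybe⁻ f (x ∷ xs) y∈ | nothing with x′ , x′∈ , eq′ ← ∈-mapMaybe⁻ f xs y∈ =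
  x′ , there x′∈ , eq′

unique-mapMaybe : (f : A → Maybe B) → (∀ {x x′ y} → f x ≡ just y → f x′ ≡ just y → x ≡ x′) →
  Unique xs → Unique (mapMaybe f xs)
unique-mapMaybe f inj []           = []
unique-mapMaybe {xs = x ∷ xs} f inj (x∉xs ∷ xs!) with f x in eq
... | nothing = unique-mapMaybe f inj xs!
... | just y  = All.tabulate (λ { y∈ refl → let x′ , x′∈ , eq′ = ∈-mapMaybe⁻ f xs y∈ in
                  All.lookup x∉xs x′∈ (inj eq eq′) })
                ∷ unique-mapMaybe f inj xs!

setPartition-≡ : {σ τ : SetPartition n} → blocks σ ≡ blocks τ → σ ≡ τ
setPartition-≡ refl = refl

-- The field is irrelevant, so a usable proof is recovered from its decision procedure.
blocks-sublist : (σ : SetPartition n) → blocks σ ⊆ subsets n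
blocks-sublist {n} (mkSetPartition bs c _) = recompute (bs ⊆? subsets n) c

blocks-isSetPartition : (σ : SetPartition n) → IsSetPartition (blocks σ)
blocks-isSetPartition (mkSetPartition bs _ p) = recompute (isSetPartition? bs) p

toSetPartition-blocks : (σ : SetPartition n) → toSetPartition (blocks σ) ≡ just σ
toSetPartition-blocks {n} σ with blocks σ ⊆? subsets n | isSetPartition? (blocks σ)
... | yes _ | yes _ = refl
... | no ¬c | _     = ⊥-elim (¬c (blocks-sublist σ))
... | yes _ | no ¬p = ⊥-elim (¬p (blocks-isSetPartition σ))

blocks-toSetPartition : (bs : List (Subset n)) {σ : SetPartition n} →
  toSetPartition bs ≡ just σ → bs ≡ blocks σ
blocks-toSetPartition {n} bs eq with bs ⊆? subsets n | isSetPartition? bs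
blocks-toSetPartition bs refl | yes _ | yes _ = refl

∈-setPartitions : (σ : SetPartition n) → σ ∈ setPartitions n
∈-setPartitions σ =
  ∈-mapMaybe⁺ toSetPartition (∈-sublists⁺ (blocks-sublist σ)) (toSetPartition-blocks σ)

setPartitions-unique : ∀ n → Unique (setPartitions n)
setPartitions-unique n = unique-mapMaybe toSetPartition
  (λ {bs} {bs′} eq eq′ →
    ≡-trans (blocks-toSetPartition bs eq) (sym (blocks-toSetPartition bs′ eq′)))
  (sublists-unique (subsets-unique n))

-- Labellings of the blocks

SameBlock : List (Subset n) → Fin n → Fin n → Set
SameBlock bs i j = Any (λ B → i ∈ₛ B × j ∈ₛ B) bs

-- The blocks are the nonempty fibres of `f`. Thus `f` determines π (`labels-unique`), while π
-- determines `f` up to renaming the labels.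
Labels : (Fin n → ℕ) → SetPartition n → Set
Labels f π = ∀ i j → SameBlock (blocks π) i j ⇔ f i ≡ f j

eNC-labels : ∀ {f} {π : SetPartition n} → Labels f π → ∀ w →
  eNC π w ≡ indicator (compatible? (tabulate f) w)
eNC-labels {n} {f} {π} labels w with n ≟ length w
... | no n≢ = sym (indicator-no (compatible? (tabulate f) w)
                    (λ (eq , _) → n≢ (≡-trans (sym (length-tabulate f)) eq)))
... | yes refl = indicator-cong (all? (distinctOn? w) (blocks π)) (compatible? (tabulate f) w)
  (λ distinct → length-tabulate f , subst Unique (sym (zip-tabulate w f))
    (Unique.tabulate⁺ (λ {i} {j} → injective distinct i j)))
  (λ (_ , u) → All.tabulate λ {B} B∈ i j i≢j i∈B j∈B eq →
    i≢j (unique-tabulate⁻ (subst Unique (zip-tabulate w f) u)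
      (cong₂ _,_ (to (labels i j) (lose B∈ (i∈B , j∈B))) eq)))
  where
  injective : All (DistinctOn w) (blocks π) → ∀ i j →
    (f i , lookup w i) ≡ (f j , lookup w j) → i ≡ j
  injective distinct i j eq with i Fin.≟ j
  ... | yes i≡j = i≡j
  ... | no i≢j with d , i∈B , j∈B ←
    All.lookupAny distinct (from (labels i j) (,-injectiveˡ eq)) =
    ⊥-elim (d i j i≢j i∈B j∈B (,-injectiveʳ eq))

Respects : (Fin n → ℕ) → (Fin n → ℕ) → Set
Respects f h = ∀ i j → f i ≡ f j → h i ≡ h j

respects? : (f h : Fin n → ℕ) → Dec (Respects f h)
respects? f h = Fin.all? λ i → Fin.all? λ j → (f i ≟ f j) →-dec (h i ≟ h j)

-- Presenting the word as `tabulate h` indexes its letters by `Fin n`, so that permuting the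
-- positions is composition of `h` with a bijection.
pNC-labels : ∀ {f} {π : SetPartition n} → Labels f π → ∀ {w h} → w ≡ tabulate h →
  pNC π w ≡ indicator (respects? f h)
pNC-labels {n} {f} {π} labels {w} {h} w≡ with n ≟ length w
... | no n≢ = ⊥-elim (n≢ (sym (≡-trans (cong length w≡) (length-tabulate h))))
... | yes refl = indicator-cong (all? (constantOn? w) (blocks π)) (respects? f h)
  (λ constant i j eq → let c , i∈B , j∈B = All.lookupAny constant (from (labels i j) eq) in
    ≡-trans (sym (w≗h i)) (≡-trans (c i j i∈B j∈B) (w≗h j)))
  (λ resp → All.tabulate λ B∈ i j i∈B j∈B →
    ≡-trans (w≗h i) (≡-trans (resp i j (to (labels i j) (lose B∈ (i∈B , j∈B)))) (sym (w≗h j))))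
  where
  w≗h : ∀ i → lookup w i ≡ h i
  w≗h = tabulate-injective (≡-trans (tabulate-lookup w) w≡)

pNC-length : ∀ (π : SetPartition n) {w} → n ≢ length w → pNC π w ≡ 0ℚ
pNC-length {n} π {w} n≢ with n ≟ length w
... | yes eq = ⊥-elim (n≢ eq)
... | no _   = refl

fiber : (Fin n → ℕ) → ℕ → Subset n
fiber f c = Vec.tabulate (λ j → does (f j ≟ c))

∈-fiber⁺ : ∀ (f : Fin n → ℕ) {c j} → f j ≡ c → j ∈ₛ fiber f c
∈-fiber⁺ f {c} {j} eq = Vec.lookup⇒[]= j (fiber f c)
  (≡-trans (Vec.lookup∘tabulate _ j) (dec-true (f j ≟ c) eq))

∈-fiber⁻ : ∀ (f : Fin n → ℕ) {c j} → j ∈ₛ fiber f c → f j ≡ c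
∈-fiber⁻ f {c} {j} j∈ with f j ≟ c
... | yes eq = eq
... | no neq with () ← ≡-trans (sym (dec-false (f j ≟ c) neq))
  (≡-trans (sym (Vec.lookup∘tabulate _ j)) (Vec.[]=⇒lookup j∈))

IsFiber : (Fin n → ℕ) → Subset n → Set
IsFiber f B = ∃[ i ] B ≡ fiber f (f i)

isFiber? : (f : Fin n → ℕ) → Decidable (IsFiber f)
isFiber? f B = Fin.any? λ i → Vec.≡-dec Bool._≟_ B (fiber f (f i))

-- Selecting from `subsets n` yields each fibre once and in the order that `SetPartition` demands;
-- only values that `f` takes give blocks, which keeps them nonempty.
fibers : (Fin n → ℕ) → List (Subset n)
fibers {n} f = filter (isFiber? f) (subsets n)

fibers-unique : (f : Fin n → ℕ) → Unique (fibers f)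
fibers-unique {n} f = Unique.filter⁺ (isFiber? f) (subsets-unique n)

∈-fibers⁺ : ∀ (f : Fin n → ℕ) i → fiber f (f i) ∈ fibers f
∈-fibers⁺ f i = ∈-filter⁺ (isFiber? f) (∈-subsets _) (i , refl)

∈-fibers⁻ : ∀ (f : Fin n → ℕ) {B} → B ∈ fibers f → IsFiber f B
∈-fibers⁻ {n} f B∈ = proj₂ (∈-filter⁻ (isFiber? f) {xs = subsets n} B∈)

fibers-isSetPartition : (f : Fin n → ℕ) → IsSetPartition (fibers f)
fibers-isSetPartition {n} f =
  All.tabulate (λ B∈ → nonempty (∈-fibers⁻ f B∈)) ,
  unique⇒allPairs (λ B∈ C∈ → disjoint (∈-fibers⁻ f B∈) (∈-fibers⁻ f C∈)) (fibers-unique f) ,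
  (λ i → lose (∈-fibers⁺ f i) (∈-fiber⁺ f refl))
  where
  nonempty : ∀ {B} → IsFiber f B → Nonempty B
  nonempty (i , refl) = i , ∈-fiber⁺ f refl
  disjoint : ∀ {B C} → IsFiber f B → IsFiber f C → B ≢ C → Empty (B ∩ C)
  disjoint (i , refl) (j , refl) B≢C (k , k∈) with k∈B , k∈C ← x∈p∩q⁻ (fiber f (f i)) _ k∈ =
    B≢C (cong (fiber f) (≡-trans (sym (∈-fiber⁻ f k∈B)) (∈-fiber⁻ f k∈C)))

fiberPartition : (Fin n → ℕ) → SetPartition n
fiberPartition {n} f = mkSetPartition (fibers f) (filter-⊆ (isFiber? f) (subsets n))
  (fibers-isSetPartition f)

fiberPartition-labels : (f : Fin n → ℕ) → Labels f (fiberPartition f)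
fiberPartition-labels f i j = mk⇔ same
  (λ eq → lose (∈-fibers⁺ f i) (∈-fiber⁺ f refl , ∈-fiber⁺ f (sym eq)))
  where
  same : SameBlock (fibers f) i j → f i ≡ f j
  same s with B , B∈ , i∈ , j∈ ← find s with k , refl ← ∈-fibers⁻ f B∈ =
    ≡-trans (∈-fiber⁻ f i∈) (sym (∈-fiber⁻ f j∈))

sameBlock-unique : {bs : List (Subset n)} → AllPairs (λ B C → Empty (B ∩ C)) bs →
  ∀ {B i j} → B ∈ bs → i ∈ₛ B → SameBlock bs i j → j ∈ₛ B
sameBlock-unique (B# ∷ _)    (here refl) i∈B (here (_ , j∈B)) = j∈B
sameBlock-unique (B# ∷ _)    (here refl) i∈B (there s)
  with B#C , i∈C , _ ← All.lookupAny B# s = ⊥-elim (B#C (_ , x∈p∩q⁺ (i∈B , i∈C)))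
sameBlock-unique (C# ∷ _)    (there B∈)  i∈B (here (i∈C , _)) =
  ⊥-elim (All.lookup C# B∈ (_ , x∈p∩q⁺ (i∈C , i∈B)))
sameBlock-unique (_ ∷ bs#)   (there B∈)  i∈B (there s) = sameBlock-unique bs# B∈ i∈B s

-- Each block is the fibre through any of its elements, and every fibre so arises because the blocks
-- cover.
labels-unique : ∀ {f} (σ : SetPartition n) → Labels f σ → σ ≡ fiberPartition f
labels-unique {n} {f} σ labels = setPartition-≡
  (sublist≡filter (isFiber? f) (blocks-sublist σ) (subsets-unique n)
    (λ B∈ → let i , i∈B = All.lookup nonempty B∈ in i , block≡fiber B∈ i∈B)
    (λ { _ (i , refl) → let B , B∈ , i∈B = find (cover i) in
         subst (_∈ blocks σ) (block≡fiber B∈ i∈B) B∈ }))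
  where
  nonempty = proj₁ (blocks-isSetPartition σ)
  disjoint = proj₁ (proj₂ (blocks-isSetPartition σ))
  cover    = proj₂ (proj₂ (blocks-isSetPartition σ))
  block≡fiber : ∀ {B i} → B ∈ blocks σ → i ∈ₛ B → B ≡ fiber f (f i)
  block≡fiber {B} {i} B∈ i∈B = ⊆-antisym
    (λ {j} j∈B → ∈-fiber⁺ f (to (labels j i) (lose B∈ (j∈B , i∈B))))
    (λ {j} j∈ → sameBlock-unique disjoint B∈ i∈B (from (labels i j) (sym (∈-fiber⁻ f j∈))))

-- Distinct labels in use have distinct fibres. Counting labels instead of blocks makes it visible
-- that permuting the positions changes nothing.
length-fibers : (f : Fin n → ℕ) → length (fibers f) ≡ length (deduplicate _≟_ (tabulate f))
length-fibers f = ≡-trans (sym (↭-length labels↭fibers)) (length-map (fiber f) labels)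
  where
  labels : List ℕ
  labels = deduplicate _≟_ (tabulate f)

  ∈-labels⁻ : ∀ {c} → c ∈ labels → ∃[ i ] c ≡ f i
  ∈-labels⁻ c∈ = ∈-tabulate⁻ (∈-deduplicate⁻ _≟_ (tabulate f) c∈)

  injective : ∀ {c d} → c ∈ labels → d ∈ labels → fiber f c ≡ fiber f d → c ≡ d
  injective c∈ d∈ eq with i , refl ← ∈-labels⁻ c∈ =
    ∈-fiber⁻ f (subst (i ∈ₛ_) eq (∈-fiber⁺ f refl))

  to-fibers : ∀ {B} → B ∈ map (fiber f) labels → B ∈ fibers f
  to-fibers B∈ with _ , c∈ , refl ← ∈-map⁻ (fiber f) B∈ with i , refl ← ∈-labels⁻ c∈ = ∈-fibers⁺ f i

  from-fibers : ∀ {B} → B ∈ fibers f → B ∈ map (fiber f) labels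
  from-fibers B∈ with i , refl ← ∈-fibers⁻ f B∈ =
    ∈-map⁺ (fiber f) (∈-deduplicate⁺ _≟_ (∈-tabulate⁺ i))

  labels↭fibers : map (fiber f) labels ↭ fibers f
  labels↭fibers = unique-↭ (unique-map injective (DecUnique.deduplicate-! _≟_ (tabulate f)))
    (fibers-unique f) to-fibers from-fibers

length-fibers-∘ : (f : Fin n → ℕ) (g g⁻¹ : Fin n → Fin n) → (∀ i → g (g⁻¹ i) ≡ i) →
  length (fibers (f ∘ g)) ≡ length (fibers f)
length-fibers-∘ f g g⁻¹ gg⁻¹ = begin
  length (fibers (f ∘ g))                       ≡⟨ length-fibers (f ∘ g) ⟩
  length (deduplicate _≟_ (tabulate (f ∘ g)))   ≡⟨ ↭-length same-labels ⟩
  length (deduplicate _≟_ (tabulate f))         ≡⟨ length-fibers f ⟨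
  length (fibers f)                             ∎
  where
  include : ∀ {c} → c ∈ tabulate (f ∘ g) → c ∈ tabulate f
  include c∈ with i , refl ← ∈-tabulate⁻ c∈ = ∈-tabulate⁺ (g i)
  include⁻¹ : ∀ {c} → c ∈ tabulate f → c ∈ tabulate (f ∘ g)
  include⁻¹ c∈ with i , refl ← ∈-tabulate⁻ c∈ =
    subst (_∈ tabulate (f ∘ g)) (cong f (gg⁻¹ i)) (∈-tabulate⁺ (g⁻¹ i))
  same-labels : deduplicate _≟_ (tabulate (f ∘ g)) ↭ deduplicate _≟_ (tabulate f)
  same-labels = unique-↭
    (DecUnique.deduplicate-! _≟_ (tabulate (f ∘ g))) (DecUnique.deduplicate-! _≟_ (tabulate f))
    (∈-deduplicate⁺ _≟_ ∘ include ∘ ∈-deduplicate⁻ _≟_ (tabulate (f ∘ g)))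
    (∈-deduplicate⁺ _≟_ ∘ include⁻¹ ∘ ∈-deduplicate⁻ _≟_ (tabulate f))

-- Labelling the blocks in the order of weakly decreasing size

elements : Subset n → List (Fin n)
elements {n} B = filter (_∈ₛ? B) (allFin n)

size : Subset n → ℕ
size B = length (elements B)

∈-elements⁺ : ∀ {B : Subset n} {i} → i ∈ₛ B → i ∈ elements B
∈-elements⁺ {B = B} {i} i∈B = ∈-filter⁺ (_∈ₛ? B) (∈-allFin i) i∈B

∈-elements⁻ : ∀ {B : Subset n} {i} → i ∈ elements B → i ∈ₛ B
∈-elements⁻ {n} {B} i∈ = proj₂ (∈-filter⁻ (_∈ₛ? B) {xs = allFin n} i∈)

-- The value 0 for the empty list is a default that no covered position reaches.
blockIndex : List (Subset n) → Fin n → ℕ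
blockIndex []       i = 0
blockIndex (B ∷ bs) i with i ∈ₛ? B
... | yes _ = 0
... | no _  = suc (blockIndex bs i)

Disjoint : List (Subset n) → Set
Disjoint = AllPairs (λ B C → Empty (B ∩ C))

blockIndex-here : ∀ {bs} {B : Subset n} {i} → i ∈ₛ B → blockIndex (B ∷ bs) i ≡ 0
blockIndex-here {B = B} {i} i∈B with i ∈ₛ? B
... | yes _  = refl
... | no i∉B = ⊥-elim (i∉B i∈B)

blockIndex-there : ∀ {bs} {B : Subset n} {i} → i ∉ₛ B →
  blockIndex (B ∷ bs) i ≡ suc (blockIndex bs i)
blockIndex-there {B = B} {i} i∉B with i ∈ₛ? B
... | yes i∈B = ⊥-elim (i∉B i∈B)
... | no _    = refl

disjoint-∉ : ∀ {bs} {B : Subset n} {i} → All (λ C → Empty (B ∩ C)) bs → Any (i ∈ₛ_) bs → i ∉ₛ B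
disjoint-∉ B# i∈bs i∈B with B#C , i∈C ← All.lookupAny B# i∈bs = B#C (_ , x∈p∩q⁺ (i∈B , i∈C))

blockIndex-same : ∀ {bs : List (Subset n)} → Disjoint bs → ∀ {i j} →
  SameBlock bs i j → blockIndex bs i ≡ blockIndex bs j
blockIndex-same {bs = B ∷ bs} (_ ∷ _) (here (i∈B , j∈B)) =
  ≡-trans (blockIndex-here {bs = bs} i∈B) (sym (blockIndex-here {bs = bs} j∈B))
blockIndex-same {bs = B ∷ bs} (B# ∷ bs#) {i} {j} (there s) = begin
  blockIndex (B ∷ bs) i   ≡⟨ blockIndex-there (disjoint-∉ B# (Any.map proj₁ s)) ⟩
  suc (blockIndex bs i)   ≡⟨ cong suc (blockIndex-same bs# s) ⟩
  suc (blockIndex bs j)   ≡⟨ blockIndex-there (disjoint-∉ B# (Any.map proj₂ s)) ⟨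
  blockIndex (B ∷ bs) j   ∎

blockIndex-same⁻ : ∀ (bs : List (Subset n)) {i j} → Any (i ∈ₛ_) bs → Any (j ∈ₛ_) bs →
  blockIndex bs i ≡ blockIndex bs j → SameBlock bs i j
blockIndex-same⁻ (B ∷ bs) {i} {j} i∈ j∈ eq with i ∈ₛ? B | j ∈ₛ? B
... | yes i∈B | yes j∈B = here (i∈B , j∈B)
... | no i∉B  | no j∉B  =
  there (blockIndex-same⁻ bs (Any.tail i∉B i∈) (Any.tail j∉B j∈) (ℕ.suc-injective eq))

-- The recursions agree: the first block receives 0 and later labels shift by one, disjointness
-- keeping the later elements out of the first block.
map-blockIndex : (bs : List (Subset n)) → Disjoint bs →
  map (blockIndex bs) (concatMap elements bs) ≡ runs (map size bs)
map-blockIndex []       _          = refl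
map-blockIndex (B ∷ bs) (B# ∷ bs#) = begin
  map (blockIndex (B ∷ bs)) (elements B ++ concatMap elements bs)
    ≡⟨ map-++ (blockIndex (B ∷ bs)) (elements B) (concatMap elements bs) ⟩
  map (blockIndex (B ∷ bs)) (elements B) ++ map (blockIndex (B ∷ bs)) (concatMap elements bs)
    ≡⟨ cong₂ _++_ (constant (elements B) (All.tabulate (blockIndex-here ∘ ∈-elements⁻)))
         (≡-trans (map-cong-local (All.tabulate (blockIndex-there ∘ disjoint-∉ B# ∘ covered)))
                  (map-∘ (concatMap elements bs))) ⟩
  replicate (size B) 0 ++ map suc (map (blockIndex bs) (concatMap elements bs))
    ≡⟨ cong (λ w → replicate (size B) 0 ++ map suc w) (map-blockIndex bs bs#) ⟩
  runs (map size (B ∷ bs)) ∎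
  where
  constant : ∀ {f : A → ℕ} (xs : List A) → All (λ x → f x ≡ 0) xs →
    map f xs ≡ replicate (length xs) 0
  constant []       []        = refl
  constant (x ∷ xs) (eq ∷ eqs) = cong₂ _∷_ eq (constant xs eqs)
  covered : ∀ {i} → i ∈ concatMap elements bs → Any (i ∈ₛ_) bs
  covered i∈ with B , B∈ , i∈B ← ∈-concatMap⁻′ elements bs i∈ = lose B∈ (∈-elements⁻ i∈B)

concatMap-elements : (bs : List (Subset n)) → IsSetPartition bs → allFin n ↭ concatMap elements bs
concatMap-elements {n} bs (_ , disjoint , cover) = unique-↭ (Unique.allFin⁺ n)
  (Unique.concat⁺
    (All.map⁺ (All.universal (λ B → Unique.filter⁺ (_∈ₛ? B) (Unique.allFin⁺ n)) bs))
    (AllPairs.map⁺ (AllPairs.map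
      (λ { B#C (i∈B , i∈C) → B#C (_ , x∈p∩q⁺ (∈-elements⁻ i∈B , ∈-elements⁻ i∈C)) }) disjoint)))
  (λ {i} _ → let B , B∈ , i∈B = find (cover i) in ∈-concatMap⁺′ B∈ (∈-elements⁺ i∈B))
  (λ {i} _ → ∈-allFin i)

-- The order is flipped because sorting is increasing while the parts of an `IntegerPartition`
-- decrease.
bySize : (n : ℕ) → DecTotalOrder _ _ _
bySize n = On.decTotalOrder (Flip.decTotalOrder ℕ.≤-decTotalOrder) (size {n})

sortedBlocks : SetPartition n → List (Subset n)
sortedBlocks {n} π = Sort.sort (bySize n) (blocks π)

sortedBlocks-↭ : (π : SetPartition n) → sortedBlocks π ↭ blocks π
sortedBlocks-↭ {n} π = Sort.sort-↭ (bySize n) (blocks π)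

sortedBlocks-isSetPartition : (π : SetPartition n) → IsSetPartition (sortedBlocks π)
sortedBlocks-isSetPartition π with nonempty , disjoint , cover ← blocks-isSetPartition π =
  All-resp-↭ p nonempty ,
  SetoidPermutation.AllPairs-resp-↭ (setoid _)
    -- Being pairwise disjoint survives reordering because disjointness is symmetric.
    (λ { B#C (i , i∈) → let i∈C , i∈B = x∈p∩q⁻ _ _ i∈ in B#C (i , x∈p∩q⁺ (i∈B , i∈C)) })
    (resp₂ _) (↭⇒↭ₛ p) disjoint ,
  (λ i → Any-resp-↭ p (cover i))
  where p = ↭-sym (sortedBlocks-↭ π)

label : SetPartition n → Fin n → ℕ
label π = blockIndex (sortedBlocks π)

label-labels : (π : SetPartition n) → Labels (label π) π
label-labels π i j with _ , disjoint , cover ← sortedBlocks-isSetPartition π = mk⇔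
  (λ s → blockIndex-same disjoint (Any-resp-↭ (↭-sym (sortedBlocks-↭ π)) s))
  (λ eq → Any-resp-↭ (sortedBlocks-↭ π)
    (blockIndex-same⁻ (sortedBlocks π) (cover i) (cover j) eq))

shape : SetPartition n → IntegerPartition
shape {n} π = mkIntegerPartition (map size (sortedBlocks π))
  (Linked.map⁺ (Sort.sort-↗ (bySize n) (blocks π)))
  (All.map⁺ (All.map (λ { (i , i∈B) → ∈-length (∈-elements⁺ i∈B) })
    (proj₁ (sortedBlocks-isSetPartition π))))

-- Listing the positions block by block instead of in natural order sorts the labels.
label-↭-runs : (π : SetPartition n) → tabulate (label π) ↭ runs (parts (shape π))
label-↭-runs {n} π =
  trans (↭-reflexive (sym (map-tabulate id (label π))))
  (trans (map⁺-↭ (label π) (concatMap-elements (sortedBlocks π) sorted))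
         (↭-reflexive (map-blockIndex (sortedBlocks π) (proj₁ (proj₂ sorted)))))
  where sorted = sortedBlocks-isSetPartition π

-- Relabelling by a permutation of the positions

-- Positions i and j share a block here when `g i` and `g j` share one in σ, so for a bijection `g`
-- this is the image of σ under its inverse.
relabel : (Fin n → Fin n) → SetPartition n → SetPartition n
relabel g σ = fiberPartition (label σ ∘ g)

relabel-labels : ∀ g (σ : SetPartition n) → Labels (label σ ∘ g) (relabel g σ)
relabel-labels g σ = fiberPartition-labels (label σ ∘ g)

-- `label` is computed afresh from the sorted blocks, so `label (relabel g σ)` may differ from
-- `label σ ∘ g`. Both label the same partition, which is all that `labels-unique` asks for.
relabel-inverse : ∀ (g h : Fin n → Fin n) → (∀ i → g (h i) ≡ i) → ∀ σ → relabel h (relabel g σ) ≡ σ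
relabel-inverse g h gh σ = sym (labels-unique σ labels)
  where
  labels : Labels (label (relabel g σ) ∘ h) σ
  labels i j = mk⇔
    (λ s → to (label-labels (relabel g σ) (h i) (h j)) (from (relabel-labels g σ (h i) (h j))
      (subst₂ _≡_ (cong (label σ) (sym (gh i))) (cong (label σ) (sym (gh j)))
        (to (label-labels σ i j) s))))
    (λ eq → from (label-labels σ i j)
      (subst₂ _≡_ (cong (label σ) (gh i)) (cong (label σ) (gh j))
        (to (relabel-labels g σ (h i) (h j)) (from (label-labels (relabel g σ) (h i) (h j)) eq))))

length-relabel : ∀ (g h : Fin n → Fin n) → (∀ i → g (h i) ≡ i) → ∀ σ →
  length (blocks (relabel g σ)) ≡ length (blocks σ)
length-relabel g h gh σ = ≡-trans (length-fibers-∘ (label σ) g h gh)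
  (cong (length ∘ blocks) (sym (labels-unique σ (label-labels σ))))

-- Moving set partitions requires a bijection of positions rather than an action on lists. Pulling
-- the permutation back along `h` rearranges the list of all positions, and `g` reads off the
-- entries.
↭-positions : ∀ {h : Fin n → A} {ys} → tabulate h ↭ ys →
  ∃[ g ] ∃[ g⁻¹ ] (∀ i → g (g⁻¹ i) ≡ i) × (∀ i → g⁻¹ (g i) ≡ i) × ys ≡ tabulate (h ∘ g)
↭-positions {n = n} {h = h} p
  with is , refl , q ← ↭-map-inv h (trans (↭-reflexive (map-tabulate id h)) p)
  with g , is≡g ← tabulation is (≡-trans (sym (↭-length q)) (length-tabulate id)) =
  -- The other inverse law follows by cancelling `g`, which is injective because the rearranged
  -- positions are distinct.
  g , g⁻¹ , gg⁻¹ , (λ i → unique-tabulate⁻ (unique-resp-↭ r (Unique.allFin⁺ n)) (gg⁻¹ (g i))) ,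
  ≡-trans (cong (map h) is≡g) (map-tabulate g h)
  where
  r : allFin n ↭ tabulate g
  r = trans q (↭-reflexive is≡g)
  preimage : ∀ i → ∃[ j ] i ≡ g j
  preimage i = ∈-tabulate⁻ (∈-resp-↭ r (∈-allFin i))
  g⁻¹ : Fin n → Fin n
  g⁻¹ i = proj₁ (preimage i)
  gg⁻¹ : ∀ i → g (g⁻¹ i) ≡ i
  gg⁻¹ i = sym (proj₂ (preimage i))

-- Symmetry of x_⟦n⟧

blockWeight : SetPartition n → ℚ
blockWeight σ = (möbius (length (blocks σ)) ℤ.* 1ℤ) ℚ./ 1

-- Every σ lies below `⟦ n ⟧` and every block inside `⊤`, so neither filter removes anything. The
-- product over the single block of `⟦ n ⟧` leaves the factor `1ℤ` seen in `blockWeight`.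
xNC-⟦⟧ : ∀ n .{{_ : NonZero n}} w →
  xNC ⟦ n ⟧ w ≡ ∑ (setPartitions n) (λ σ → blockWeight σ * pNC σ w)
xNC-⟦⟧ n@(suc _) w = begin
  ∑ (filter (_≤ₚ? ⟦ n ⟧) (setPartitions n)) (λ σ → (u σ ⟦ n ⟧ ℚ./ 1) * pNC σ w)
    ≡⟨ cong (λ σs → ∑ σs (λ σ → (u σ ⟦ n ⟧ ℚ./ 1) * pNC σ w))
         (filter-all (_≤ₚ? ⟦ n ⟧) (All.universal (λ σ → All.universal (here ∘ ⊆-max) (blocks σ))
                                                 (setPartitions n))) ⟩
  ∑ (setPartitions n) (λ σ → (u σ ⟦ n ⟧ ℚ./ 1) * pNC σ w)
    ≡⟨ ∑-cong (setPartitions n) (λ {σ} _ →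
         cong (λ bs → ((möbius (length bs) ℤ.* 1ℤ) ℚ./ 1) * pNC σ w)
              (filter-all (_⊆ₛ? ⊤) (All.universal ⊆-max (blocks σ)))) ⟩
  ∑ (setPartitions n) (λ σ → blockWeight σ * pNC σ w) ∎

-- A bijection `g` of the positions carries p_σ at `h` to the power sum of `relabel g σ` at `h ∘ g`
-- and keeps the weight, so it reindexes the sum. Words of a length other than `n` have coefficient
-- 0.
xNC-↭ : ∀ n .{{_ : NonZero n}} {v w} → v ↭ w → xNC ⟦ n ⟧ v ≡ xNC ⟦ n ⟧ w
xNC-↭ n {v} {w} p = ≡-trans (xNC-⟦⟧ n v) (≡-trans (sums (n ≟ length v)) (sym (xNC-⟦⟧ n w)))
  where
  vanish : ∀ w → n ≢ length w → ∑ (setPartitions n) (λ σ → blockWeight σ * pNC σ w) ≡ 0ℚ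
  vanish w n≢ = ≡-trans (∑-cong (setPartitions n) (λ {σ} _ →
    ≡-trans (cong (blockWeight σ *_) (pNC-length σ n≢)) (*-zeroʳ (blockWeight σ))))
    (∑-zero (setPartitions n))

  sums : Dec (n ≡ length v) → ∑ (setPartitions n) (λ σ → blockWeight σ * pNC σ v) ≡
    ∑ (setPartitions n) (λ σ → blockWeight σ * pNC σ w)
  sums (no n≢)  = ≡-trans (vanish v n≢) (sym (vanish w (λ eq → n≢ (≡-trans eq (sym (↭-length p))))))
  sums (yes eq)
    with h , refl ← tabulation v (sym eq)
    with g , g⁻¹ , gg⁻¹ , g⁻¹g , refl ← ↭-positions p =
    ∑-bijection (setPartitions-unique n) (setPartitions-unique n) (relabel g) (relabel g⁻¹)
      (λ _ → ∈-setPartitions _) (λ _ → ∈-setPartitions _)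
      (λ {σ} _ → relabel-inverse g g⁻¹ gg⁻¹ σ) (λ {σ} _ → relabel-inverse g⁻¹ g g⁻¹g σ)
      (λ {σ} _ → cong₂ _*_
        (cong (λ k → (möbius k ℤ.* 1ℤ) ℚ./ 1) (sym (length-relabel g g⁻¹ gg⁻¹ σ)))
        (begin
          pNC σ (tabulate h)                       ≡⟨ pNC-labels (label-labels σ) refl ⟩
          indicator (respects? (label σ) h)
            ≡⟨ indicator-cong (respects? (label σ) h) (respects? (label σ ∘ g) (h ∘ g))
                 (λ resp i j → resp (g i) (g j))
                 (λ resp i j eq → subst₂ _≡_ (cong h (gg⁻¹ i)) (cong h (gg⁻¹ j))
                   (resp (g⁻¹ i) (g⁻¹ j)
                     (subst₂ _≡_ (cong (label σ) (sym (gg⁻¹ i)))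
                                 (cong (label σ) (sym (gg⁻¹ j))) eq))) ⟩
          indicator (respects? (label σ ∘ g) (h ∘ g)) ≡⟨ pNC-labels (relabel-labels g σ) refl ⟨
          pNC (relabel g σ) (tabulate (h ∘ g))     ∎))

-- Transfer of e-positivity between NCSym and Sym

_≟ₛ_ : DecidableEquality (Σ[ n ∈ ℕ ] SetPartition n)
(m , σ) ≟ₛ (n , τ) with m ≟ n
... | no m≢n   = no λ { refl → m≢n refl }
... | yes refl = map′ (λ eq → cong (m ,_) (setPartition-≡ eq)) (λ { refl → refl })
  (≡-dec (Vec.≡-dec Bool._≟_) (blocks σ) (blocks τ))

_≟ᵢ_ : DecidableEquality IntegerPartition
λ₁ ≟ᵢ λ₂ = map′ (λ { refl → refl }) (λ { refl → refl }) (≡-dec _≟_ (parts λ₁) (parts λ₂))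

ρ-eNC : ∀ {n} (π : SetPartition n) m →
  coeff (ρ (eNC π)) m ≡ factorials (parts (shape π)) * coeff (eSym (shape π)) m
ρ-eNC π m = begin
  ∑ (arr m) (eNC π)                     ≡⟨ ∑-cong (arr m) (λ {w} _ → eNC-labels (label-labels π) w) ⟩
  fillings (tabulate (label π)) m       ≡⟨ fillings-↭ (label-↭-runs π) m ⟩
  fillings (runs (parts (shape π))) m   ≡⟨ fillings-runs (parts (shape π)) m ⟩
  factorials (parts (shape π)) * coeff (eSym (shape π)) m ∎

-- Set partitions of equal shape have the same image, so the terms may repeat an index;
-- `nonNegative-combination` collects them.
ρ-ePositive : ∀ f → EPositiveNC f → EPositiveSym (ρ f)
ρ-ePositive f (x , positive) = nonNegative-combination _≟ᵢ_ terms nonNeg λ m → begin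
  ∑ (arr m) f
    ≡⟨ ∑-cong (arr m) (λ {w} _ → expands x w) ⟩
  ∑ (arr m) (λ w → ∑ (support x) (λ i → coefficient x i * eNC (proj₂ i) w))
    ≡⟨ ∑-swap (arr m) (support x) _ ⟩
  ∑ (support x) (λ i → ∑ (arr m) (λ w → coefficient x i * eNC (proj₂ i) w))
    ≡⟨ ∑-cong (support x) (λ {i} _ → image i m) ⟩
  ∑ (support x) (λ i → proj₂ (term i) * coeff (eSym (proj₁ (term i))) m)
    ≡⟨ ∑-map term (support x) _ ⟨
  ∑ terms (λ (μ , q) → q * coeff (eSym μ) m) ∎
  where
  term : Σ[ n ∈ ℕ ] SetPartition n → IntegerPartition × ℚ
  term i = shape (proj₂ i) , coefficient x i * factorials (parts (shape (proj₂ i)))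

  terms : List (IntegerPartition × ℚ)
  terms = map term (support x)

  nonNeg : ∀ {μ q} → (μ , q) ∈ terms → 0ℚ ≤ q
  nonNeg t∈ with i , _ , refl ← ∈-map⁻ term t∈ =
    nonNeg*nonNeg (≢0⇒pos⇒nonNeg (positive i)) (ℚ.<⇒≤ (factorials>0 (parts (shape (proj₂ i)))))

  image : ∀ i m → ∑ (arr m) (λ w → coefficient x i * eNC (proj₂ i) w) ≡
    proj₂ (term i) * coeff (eSym (proj₁ (term i))) m
  image i m = begin
    ∑ (arr m) (λ w → coefficient x i * eNC (proj₂ i) w)
      ≡⟨ ∑-*ˡ (coefficient x i) (arr m) (eNC (proj₂ i)) ⟩
    coefficient x i * coeff (ρ (eNC (proj₂ i))) m
      ≡⟨ cong (coefficient x i *_) (ρ-eNC (proj₂ i) m) ⟩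
    coefficient x i * (factorials (parts (shape (proj₂ i))) * coeff (eSym (shape (proj₂ i))) m)
      ≡⟨ *-assoc (coefficient x i) _ _ ⟨
    proj₂ (term i) * coeff (eSym (shape (proj₂ i))) m ∎

wordPartition : (b : Word) → Σ[ n ∈ ℕ ] SetPartition n
wordPartition b = length b , fiberPartition (lookup b)

fillings-eNC : ∀ w m → fillings w m ≡ ∑ (arr m) (λ b → eNC (proj₂ (wordPartition b)) w)
fillings-eNC w m = ∑-cong (arr m) λ {b} _ → begin
  indicator (compatible? w b)
    ≡⟨ indicator-cong (compatible? w b) (compatible? b w) compatible-sym compatible-sym ⟩
  indicator (compatible? b w)
    ≡⟨ cong (λ v → indicator (compatible? v w)) (tabulate-lookup b) ⟨
  indicator (compatible? (tabulate (lookup b)) w)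
    ≡⟨ eNC-labels (fiberPartition-labels (lookup b)) w ⟨
  eNC (proj₂ (wordPartition b)) w ∎

module _ (μ : IntegerPartition) where

  private
    -- By `fillings-symmetric` and `fillings-runs`, `card (arr m) * fillings w (parts μ)` is this
    -- product times the coefficient of `m` in e_μ, so the product has to be divided out.
    inverse : ∃[ r ] 0ℚ < r × r * (card (arr (parts μ)) * factorials (parts μ)) ≡ 1ℚ
    inverse = reciprocal (pos*pos (card-arr>0 (parts μ)) (factorials>0 (parts μ)))

  liftWeight : ℚ
  liftWeight = proj₁ inverse

  liftWeight>0 : 0ℚ < liftWeight
  liftWeight>0 = proj₁ (proj₂ inverse)

  -- The count `card (arr m)` is the same for every μ. As an outer factor it comes out of the whole
  -- expansion and cancels against the one multiplying `f w`.
  eSym-lift : ∀ {w m} → w ↭ runs m →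
    coeff (eSym μ) m ≡ card (arr m) * (liftWeight * fillings w (parts μ))
  eSym-lift {w} {m} p = begin
    coeff (eSym μ) m                                       ≡⟨ *-identityˡ _ ⟨
    1ℚ * coeff (eSym μ) m
      ≡⟨ cong (_* coeff (eSym μ) m) (proj₂ (proj₂ inverse)) ⟨
    liftWeight * (card (arr (parts μ)) * factorials (parts μ)) * coeff (eSym μ) m
      ≡⟨ *-assoc liftWeight _ _ ⟩
    liftWeight * (card (arr (parts μ)) * factorials (parts μ) * coeff (eSym μ) m)
      ≡⟨ cong (liftWeight *_) (*-assoc (card (arr (parts μ))) _ _) ⟩
    liftWeight * (card (arr (parts μ)) * (factorials (parts μ) * coeff (eSym μ) m))
      ≡⟨ cong (λ q → liftWeight * (card (arr (parts μ)) * q)) (fillings-runs (parts μ) m) ⟨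
    liftWeight * (card (arr (parts μ)) * fillings (runs (parts μ)) m)
      ≡⟨ cong (liftWeight *_) (fillings-symmetric {m = m} p (parts μ)) ⟨
    liftWeight * (card (arr m) * fillings w (parts μ))
      ≡⟨ *.x∙yz≈y∙xz liftWeight (card (arr m)) _ ⟩
    card (arr m) * (liftWeight * fillings w (parts μ))     ∎

-- Each e_μ is replaced by its lift, with one e_π for every arrangement of the label word. Equality
-- is checked word by word, after multiplication by the positive number of arrangements.
ρ-ePositive⁻ : ∀ f → (∀ {v w} → v ↭ w → f v ≡ f w) → EPositiveSym (ρ f) → EPositiveNC f
ρ-ePositive⁻ f symmetric (x , positive) = nonNegative-combination _≟ₛ_ terms nonNeg expansion
  where
  weight : IntegerPartition → ℚ
  weight μ = coefficient x μ * liftWeight μ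

  lifts : IntegerPartition → List ((Σ[ n ∈ ℕ ] SetPartition n) × ℚ)
  lifts μ = map (λ b → wordPartition b , weight μ) (arr (parts μ))

  terms : List ((Σ[ n ∈ ℕ ] SetPartition n) × ℚ)
  terms = concatMap lifts (support x)

  nonNeg : ∀ {i q} → (i , q) ∈ terms → 0ℚ ≤ q
  nonNeg t∈ with μ , _ , t∈μ ← ∈-concatMap⁻′ lifts (support x) t∈
    with _ , _ , refl ← ∈-map⁻ _ t∈μ =
    nonNeg*nonNeg (≢0⇒pos⇒nonNeg (positive μ)) (ℚ.<⇒≤ (liftWeight>0 μ))

  ∑-lifts : ∀ μ w → ∑ (lifts μ) (λ (i , q) → q * eNC (proj₂ i) w) ≡ weight μ * fillings w (parts μ)
  ∑-lifts μ w = begin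
    ∑ (lifts μ) (λ (i , q) → q * eNC (proj₂ i) w)
      ≡⟨ ∑-map _ (arr (parts μ)) _ ⟩
    ∑ (arr (parts μ)) (λ b → weight μ * eNC (proj₂ (wordPartition b)) w)
      ≡⟨ ∑-*ˡ (weight μ) (arr (parts μ)) _ ⟩
    weight μ * ∑ (arr (parts μ)) (λ b → eNC (proj₂ (wordPartition b)) w)
      ≡⟨ cong (weight μ *_) (fillings-eNC w (parts μ)) ⟨
    weight μ * fillings w (parts μ) ∎

  expansion : ∀ w → f w ≡ ∑ terms (λ (i , q) → q * eNC (proj₂ i) w)
  expansion w with m , p ← content w = ≡-trans
    (*-cancel-pos (card-arr>0 m) (begin
      -- By symmetry `f` takes one value on all arrangements of `m`, so this is a coefficient of
      -- `ρ f`, to which the given expansion applies.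
      card (arr m) * f w
        ≡⟨ ∑-const (arr m) (λ v∈ → symmetric (trans (∈-arr⁻ m v∈) (↭-sym p))) ⟨
      coeff (ρ f) m
        ≡⟨ expands x m ⟩
      ∑ (support x) (λ μ → coefficient x μ * coeff (eSym μ) m)
        ≡⟨ ∑-cong (support x) (λ {μ} _ → scaled μ) ⟩
      ∑ (support x) (λ μ → card (arr m) * (weight μ * fillings w (parts μ)))
        ≡⟨ ∑-*ˡ (card (arr m)) (support x) _ ⟩
      card (arr m) * ∑ (support x) (λ μ → weight μ * fillings w (parts μ)) ∎))
    (begin
      ∑ (support x) (λ μ → weight μ * fillings w (parts μ))
        ≡⟨ ∑-cong (support x) (λ {μ} _ → ∑-lifts μ w) ⟨
      ∑ (support x) (λ μ → ∑ (lifts μ) (λ (i , q) → q * eNC (proj₂ i) w))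
        ≡⟨ ∑-concatMap lifts (support x) _ ⟨
      ∑ terms (λ (i , q) → q * eNC (proj₂ i) w) ∎)
    where
    scaled : ∀ μ → coefficient x μ * coeff (eSym μ) m ≡
      card (arr m) * (weight μ * fillings w (parts μ))
    scaled μ = begin
      coefficient x μ * coeff (eSym μ) m
        ≡⟨ cong (coefficient x μ *_) (eSym-lift μ {m = m} p) ⟩
      coefficient x μ * (card (arr m) * (liftWeight μ * fillings w (parts μ)))
        ≡⟨ *.x∙yz≈y∙xz (coefficient x μ) (card (arr m)) _ ⟩
      card (arr m) * (coefficient x μ * (liftWeight μ * fillings w (parts μ)))
        ≡⟨ cong (card (arr m) *_) (*-assoc (coefficient x μ) _ _) ⟨
      card (arr m) * (weight μ * fillings w (parts μ)) ∎

    *-cancel-pos : ∀ {p q r} → 0ℚ < p → p * q ≡ p * r → q ≡ r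
    *-cancel-pos {p} {q} {r} 0<p eq with p⁻¹ , _ , inv ← reciprocal 0<p = begin
      q               ≡⟨ *-identityˡ q ⟨
      1ℚ * q          ≡⟨ cong (_* q) inv ⟨
      p⁻¹ * p * q     ≡⟨ *-assoc p⁻¹ p q ⟩
      p⁻¹ * (p * q)   ≡⟨ cong (p⁻¹ *_) eq ⟩
      p⁻¹ * (p * r)   ≡⟨ *-assoc p⁻¹ p r ⟨
      p⁻¹ * p * r     ≡⟨ cong (_* r) inv ⟩
      1ℚ * r          ≡⟨ *-identityˡ r ⟩
      r               ∎

theorem4p5 : (n : ℕ) → .{{_ : NonZero n}} → EPositiveNC (xNC ⟦ n ⟧) ⇔ EPositiveSym (xSym n)
theorem4p5 n = mk⇔ (ρ-ePositive (xNC ⟦ n ⟧)) (ρ-ePositive⁻ (xNC ⟦ n ⟧) (xNC-↭ n))
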